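{- Let $D$ be a (weakly connected) Eulerian ribbon digraph, and let $\overrightarrow{uv}$ and $\overrightarrow{wz}$ be arbitrary edges of $D$ (some of $u,v,w,z$ may coincide). Let $x\in S(D)$ and let $\mathcal{E}$, $\mathcal{E}'$ be Eulerian tours of $D$ compatible with the ribbon structure. If $$r_u\big(x, A_{\overrightarrow{uv}}(\mathcal{E})\big)=A_{\overrightarrow{uv}}(\mathcal{E}'),$$ then $$r_w\big(x, A_{\overrightarrow{wz}}(\mathcal{E})\big)=A_{\overrightarrow{wz}}(\mathcal{E}').$$
   Context: A ribbon digraph is a finite directed multigraph $D=(V,E)$ (loops and multiple edges allowed) together with, at each vertex $v$, a cyclic ordering of all edge-ends (in- and out-) incident to $v$. $D$ is Eulerian if in-degree equals out-degree at every vertex; $D$ is assumed weakly connected. For an out-edge $e$ of $v$, ${\rm nextout}(v,e)$ is the next out-edge of $v$ after $e$ in the cyclic order at $v$. An Eulerian tour is a cyclic ordering of $E$ in which the head of each edge equals the tail of the following edge (no distinguished starting point). It is compatible with the ribbon structure if for every vertex $v$, the cyclic order in which the tour traverses the out-edges of $v$ agrees with the cyclic order of the out-edges of $v$ induced by the ribbon structure (nothing is required about in-edges). ${\rm Arb}(D,v)$ denotes the set of spanning in-arborescences rooted at $v$ (spanning trees of the underlying graph in which every vertex has a directed path to $v$). For a compatible tour $\mathcal{E}$ and an edge $\overrightarrow{vw}$, $A_{\overrightarrow{vw}}(\mathcal{E})$ is obtained by reading $\mathcal{E}$ with $\overrightarrow{vw}$ as its first edge and taking, for every vertex $u\neq v$,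 the out-edge of $u$ traversed last; this is an element of ${\rm Arb}(D,v)$, and $\mathcal{E}\mapsto A_{\overrightarrow{vw}}(\mathcal{E})$ is a bijection from compatible Eulerian tours to ${\rm Arb}(D,v)$. Chip configurations are vectors $x\in\mathbb{Z}^V$; $\mathbb{Z}^V_0$ is the subgroup of vectors with coordinate sum $0$. Firing $v$ decreases $x(v)$ by the out-degree of $v$ and increases $x(w)$ by the number of edges $\overrightarrow{vw}$. $x\sim y$ if $y$ is obtained from $x$ by a sequence of firings. The sandpile group is $S(D)=\mathbb{Z}^V_0/\sim$. A rotor configuration $\varrho$ assigns to each vertex $v$ an out-edge $\varrho(v)$ with tail $v$. A routing at $v$ on a pair $(x,\varrho)$ replaces $\varrho(v)$ by $\varrho'(v)={\rm nextout}(v,\varrho(v))$ and replaces $x$ by $x-\mathbf{1}_v+\mathbf{1}_{v'}$, where $v'$ is the head of $\varrho'(v)$; the routing is legal if $x(v)>0$. Two pairs are linearly equivalent, $(x_1,\varrho_1)\sim(x_2,\varrho_2)$, if one is reachable from the other by a sequence of (not necessarily legal) routings. Rotor-routing action $r_v$ of $S(D)$ on ${\rm Arb}(D,v)$ (Holroyd et al.): for $x\in S(D)$ and $T\in{\rm Arb}(D,v)$, choose a representative $x'\sim x$ with $x'(u)\ge 0$ for all $u\neq v$, an out-edge $\overrightarrow{vw}$, and start from $(x',T\cup\{\overrightarrow{vw}\})$; perform legal routings at vertices other than $v$ until all chips are at $v$. The final rotors at vertices $u\neq v$ form an arborescence in ${\rm Arb}(D,v)$, which is $r_v(x,T)$;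 this is well defined and is a simply transitive group action. Equivalently, $r_v(x,T)=T'$ iff $(x,T\cup\{\overrightarrow{vw}\})\sim(\mathbf{0},T'\cup\{\overrightarrow{vw}\})$ for an (any) out-edge $\overrightarrow{vw}$ of $v$. -}

module Defs where

open import Data.Nat using (ℕ)
open import Data.Integer using (ℤ; +_; _+_; _-_; _*_; _<_; _≤_)
open import Data.Fin using (Fin; _≟_)
open import Data.Fin.Subset using (Subset; _∈_)
open import Data.List using (List; []; _∷_; _++_; length; filter; map; mapMaybe; allFin; foldr)
open import Data.List.Relation.Unary.All using (All)
open import Data.List.Relation.Binary.Permutation.Propositional using (_↭_)
open import Data.Maybe using (Maybe; just; nothing)
open import Data.Product using (Σ; ∃; _×_; _,_; proj₁)
open import Data.Sum using (_⊎_; inj₁; inj₂)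
open import Relation.Nullary using (¬_; yes; no)
open import Relation.Binary.PropositionalEquality using (_≡_)
open import Relation.Binary.Construct.Closure.ReflexiveTransitive using (Star)
open import Function.Bundles using (_⇔_)

Rotation : {A : Set} → List A → List A → Set
Rotation {A} xs ys = Σ (List A) λ as → Σ (List A) λ bs → (xs ≡ as ++ bs) × (ys ≡ bs ++ as)

-- b is the cyclic successor of a in the cyclic order represented by L
-- (L is always duplicate-free where this is used)
data CycNext {A : Set} (L : List A) (a b : A) : Set where
  inner  : (xs ys : List A) → L ≡ xs ++ a ∷ b ∷ ys → CycNext L a b
  wrap   : (xs : List A) → L ≡ b ∷ xs ++ a ∷ [] → CycNext L a b
  single : L ≡ a ∷ [] → b ≡ a → CycNext L a b

-- an edge-end: inj₁ e = the tail-end (out-end) of e, inj₂ e = the head-end (in-end) of e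
End : ℕ → Set
End m = Fin m ⊎ Fin m

record RibbonDigraph : Set where
  field
    n    : ℕ
    m    : ℕ
    tail : Fin m → Fin n
    head : Fin m → Fin n
    -- ribbon structure: at each vertex a cyclic ordering (a list up to
    -- rotation) of all edge-ends incident to that vertex
    rot  : Fin n → List (End m)

  outEdges : Fin n → List (Fin m)
  outEdges v = filter (λ e → tail e ≟ v) (allFin m)

  inEdges : Fin n → List (Fin m)
  inEdges v = filter (λ e → head e ≟ v) (allFin m)

  -- all edge-ends incident to v (a loop contributes both of its ends)
  ends : Fin n → List (End m)
  ends v = map inj₁ (outEdges v) ++ map inj₂ (inEdges v)

  field
    rot-ends : ∀ v → rot v ↭ ends v

module _ (D : RibbonDigraph) where
  open RibbonDigraph D

  isOut : End m → Maybe (Fin m)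
  isOut (inj₁ e) = just e
  isOut (inj₂ _) = nothing

  outOrder : Fin n → List (Fin m)
  outOrder v = mapMaybe isOut (rot v)

  NextOut : Fin n → Fin m → Fin m → Set
  NextOut v e e' = CycNext (outOrder v) e e'

  Adj : Fin n → Fin n → Set
  Adj a b = Σ (Fin m) λ e → ((tail e ≡ a) × (head e ≡ b)) ⊎ ((tail e ≡ b) × (head e ≡ a))

  WeaklyConnected : Set
  WeaklyConnected = ∀ a b → Star Adj a b

  Eulerian : Set
  Eulerian = ∀ v → length (inEdges v) ≡ length (outEdges v)

  -- Eulerian tour: a cyclic ordering (list up to rotation) of E
  EulerianTour : List (Fin m) → Set
  EulerianTour t = (t ↭ allFin m) × (∀ e f → CycNext t e f → head e ≡ tail f)

  Compatible : List (Fin m) → Set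
  Compatible t = ∀ v → Rotation (filter (λ e → tail e ≟ v) t) (outOrder v)

  CompatibleTour : List (Fin m) → Set
  CompatibleTour t = EulerianTour t × Compatible t

  LastOut : Fin n → List (Fin m) → Fin m → Set
  LastOut v r f = (¬ tail f ≡ v) ×
    Σ (List (Fin m)) λ pre → Σ (List (Fin m)) λ post →
      (r ≡ pre ++ f ∷ post) × All (λ g → ¬ tail g ≡ tail f) post

  IsA : Fin m → List (Fin m) → Subset m → Set
  IsA e₀ t T = Σ (List (Fin m)) λ as → Σ (List (Fin m)) λ bs →
    (t ≡ as ++ e₀ ∷ bs) × (∀ f → (f ∈ T) ⇔ LastOut (tail e₀) (e₀ ∷ bs ++ as) f)

  Chips : Set
  Chips = Fin n → ℤ

  sumℤ : Chips → ℤ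
  sumℤ x = foldr _+_ (+ 0) (map x (allFin n))

  ind : Fin n → Fin n → ℤ
  ind a b with a ≟ b
  ... | yes _ = + 1
  ... | no  _ = + 0

  nEdges : Fin n → Fin n → ℕ
  nEdges a b = length (filter (λ e → head e ≟ b) (outEdges a))

  fire : Fin n → Chips → Chips
  fire v x u = x u - ind v u * + length (outEdges v) + + nEdges v u

  FireStep : Chips → Chips → Set
  FireStep x y = Σ (Fin n) λ v → ∀ u → y u ≡ fire v x u

  _∼_ : Chips → Chips → Set
  x ∼ y = Star FireStep x y

  Rotors : Set
  Rotors = Fin n → Fin m

  State : Set
  State = Chips × Rotors

  Routing : Fin n → State → State → Set
  Routing u (x , ρ) (x' , ρ') = Σ (Fin m) λ e' →
    NextOut u (ρ u) e' × (ρ' u ≡ e') × (∀ w → ¬ w ≡ u → ρ' w ≡ ρ w) ×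
    (∀ w → x' w ≡ x w - ind u w + ind (head e') w)

  LegalAway : Fin n → State → State → Set
  LegalAway v s s' = Σ (Fin n) λ u → (¬ u ≡ v) × (+ 0 < proj₁ s u) × Routing u s s'

  RotorAct : Fin n → Chips → Subset m → Subset m → Set
  RotorAct v x T T' =
    Σ Chips λ x' → (x' ∼ x) × (∀ u → ¬ u ≡ v → + 0 ≤ x' u) ×
    Σ (Fin m) λ e₀ → (tail e₀ ≡ v) ×
    Σ Rotors λ ρ → (∀ u → tail (ρ u) ≡ u) × (ρ v ≡ e₀) × (∀ u → ¬ u ≡ v → ρ u ∈ T) ×
    Σ Chips λ y → Σ Rotors λ ρ' →
      Star (LegalAway v) (x' , ρ) (y , ρ') ×
      (∀ u → ¬ u ≡ v → y u ≡ + 0) ×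
      (∀ f → (f ∈ T') ⇔ ((¬ tail f ≡ v) × (ρ' (tail f) ≡ f)))

{-# OPTIONS --safe #-}
-- Call two chip-and-rotor states equivalent if routings lead from one to the other; in an Eulerian
-- digraph this is symmetric, because routing every v exactly deg v times changes nothing.
-- Read a compatible tour from an edge e and let ρ(e) consist of the last exits of all vertices,
-- the root included. One chip at the tail of e, routed from ρ(e), traverses the tour, so the states
-- (1_{tail e}, ρ(e)) are equivalent for all e. Adding x and comparing the two tours carries an
-- equivalence (x, ρ(uv)) ~ (0, ρ'(uv)) to (x, ρ(wz)) ~ (0, ρ'(wz)). To realise the latter by legal
-- routings, first fire so that all vertices other than w carry enough chips, w is not routed
-- at all, and every other vertex is routed a nonnegative number of times. Then any vertex holding
-- a chip still has routings left, and if no chip is left outside w while some routings are, then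
-- the vertices with routings left are closed under following the final rotors, contradicting that
-- these form an arborescence.
module Submission where

open import Defs
import Algebra.Properties.Semiring.Sum as SemiringSum
open import Data.Empty using (⊥; ⊥-elim)
open import Data.Fin using (Fin; zero; suc; _≟_)
open import Data.Fin.Properties using (suc-injective; any?)
open import Data.Fin.Subset using (Subset)
import Data.Fin.Subset as Subset
open import Data.Integer as ℤ using (ℤ; +_; -_; _+_; _-_; _*_; _≤_; _<_)
import Data.Integer.Properties as ℤ
open import Data.Integer.Tactic.RingSolver using (solve-∀)
open import Data.List hiding (tail; head; sum)
open import Data.List.Properties
open import Data.List.Membership.Propositional using (_∈_)
open import Data.List.Membership.Propositional.Properties
open import Data.List.Relation.Binary.Permutation.Propositional using (_↭_; ↭-sym; ↭-trans; ↭-reflexive; ↭⇒↭ₛ)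
open import Data.List.Relation.Binary.Permutation.Propositional.Properties using (∈-resp-↭; ↭-length; filter-↭; mapMaybe-↭; ++-comm)
import Data.List.Relation.Binary.Permutation.Setoid.Properties as Perm
open import Data.List.Relation.Unary.All as All using (All; []; _∷_)
open import Data.List.Relation.Unary.AllPairs using ([]; _∷_)
open import Data.List.Relation.Unary.Any using (here; there)
open import Data.List.Relation.Unary.Unique.Propositional using (Unique)
import Data.List.Relation.Unary.Unique.Propositional.Properties as Unique
open import Data.Nat as ℕ using (ℕ; zero; suc; _∸_; z≤n; s≤s)
open import Data.Nat.DivMod using (_/_; _%_; m≡m%n+[m/n]*n; m%n<n)
import Data.Nat.Properties as ℕ
open import Data.Product using (Σ; ∃; ∃₂; _×_; _,_; proj₁; proj₂)
open import Data.Sum using (inj₁; inj₂; _⊎_)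
open import Function using (_∘_; _⇔_; mk⇔; Equivalence)
open import Relation.Binary.Construct.Closure.ReflexiveTransitive using (Star; ε; _◅_)
open import Relation.Binary.PropositionalEquality hiding ([_])
open import Relation.Nullary
open import Relation.Nullary.Decidable using (decidable-stable)
open import Algebra.Properties.CommutativeMonoid.Sum ℤ.+-0-commutativeMonoid using (sum; sum-cong-≗; ∑-distrib-+; ∑-comm; sum-replicate-zero)

private variable A : Set

-- Rotations of lists and cyclic successors

rotation-sym : {xs ys : List A} → Rotation xs ys → Rotation ys xs
rotation-sym (as , bs , p , q) = bs , as , q , p

rotation-refl : (xs : List A) → Rotation xs xs
rotation-refl xs = [] , xs , refl , sym (++-identityʳ xs)

rotation-step : {xs ys : List A} {e : A} → Rotation xs (e ∷ ys) → Rotation xs (ys ∷ʳ e)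
rotation-step {xs = xs} {ys} {e} (as , [] , p , q) =
  [ e ] , ys , trans p (trans (++-identityʳ as) (sym q)) , refl
rotation-step (as , e ∷ bs , refl , refl) =
  as ∷ʳ e , bs , sym (++-assoc as [ e ] bs) , ++-assoc bs as [ e ]

rotation-swap : {xs : List A} (as bs : List A) → Rotation xs (as ++ bs) → Rotation xs (bs ++ as)
rotation-swap {xs = xs} [] bs r = subst (Rotation xs) (sym (++-identityʳ bs)) r
rotation-swap {xs = xs} (e ∷ as) bs r =
  subst (Rotation xs) (++-assoc bs [ e ] as)
    (rotation-swap as (bs ∷ʳ e)
      (subst (Rotation xs) (++-assoc as bs [ e ]) (rotation-step r)))

rotation-trans : {xs ys zs : List A} → Rotation xs ys → Rotation ys zs → Rotation xs zs
rotation-trans r (as , bs , refl , refl) = rotation-swap as bs r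

rotation-∈ : {xs ys : List A} {a : A} → Rotation xs ys → a ∈ xs → a ∈ ys
rotation-∈ (as , bs , refl , refl) a∈ with ∈-++⁻ as a∈
... | inj₁ p = ∈-++⁺ʳ bs p
... | inj₂ p = ∈-++⁺ˡ p

-- A rotation ending in `a` cuts the cycle just after one occurrence of `a` in `L`. In a
-- duplicate-free list that occurrence is unique, and hence so is the successor.
rotation-last : {L : List A} {a : A} (zs : List A) → Rotation L (zs ∷ʳ a) →
  ∃₂ λ p q → L ≡ p ++ a ∷ q × zs ≡ q ++ p
rotation-last {L = L} {a} zs (as , bs , eL , eR) with initLast as
... | [] = zs , [] , trans eL (trans (sym (++-identityʳ bs)) (sym eR)) , refl
... | as′ ∷ʳ′ c with ∷ʳ-injective zs (bs ++ as′) (trans eR (sym (++-assoc bs as′ [ c ])))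
... | refl , refl = as′ , bs , trans eL (++-assoc as′ [ c ] bs) , refl

unique-split : {a : A} (xs xs′ : List A) {ys ys′ : List A} → Unique (xs ++ a ∷ ys) →
  xs ++ a ∷ ys ≡ xs′ ++ a ∷ ys′ → xs ≡ xs′ × ys ≡ ys′
unique-split [] [] u refl = refl , refl
unique-split [] (x ∷ xs′) (n ∷ u) refl = ⊥-elim (All.lookup n (∈-insert xs′) refl)
unique-split (x ∷ xs) [] (n ∷ u) refl = ⊥-elim (All.lookup n (∈-insert xs) refl)
unique-split (x ∷ xs) (x′ ∷ xs′) (n ∷ u) eq with ∷-injective eq
... | refl , eq′ with unique-split xs xs′ u eq′
... | refl , refl = refl , refl

-- b follows a cyclically in L iff some rotation of L starts with b and ends with a
Follows : List A → A → A → Set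
Follows {A} L a b = Σ (List A) λ zs → Σ (List A) λ ws → Rotation L (zs ∷ʳ a) × zs ∷ʳ a ≡ b ∷ ws

cycNext⇒follows : {L : List A} {a b : A} → CycNext L a b → Follows L a b
cycNext⇒follows {a = a} {b} (inner xs ys refl) = b ∷ ys ++ xs , _ ,
  (xs ∷ʳ a , b ∷ ys , sym (++-assoc xs [ a ] (b ∷ ys)) , cong (b ∷_) (++-assoc ys xs [ a ])) , refl
cycNext⇒follows {b = b} (wrap xs refl) = b ∷ xs , _ , rotation-refl _ , refl
cycNext⇒follows {a = a} (single refl refl) = [] , [] , rotation-refl _ , refl

-- With `L` split as `p ++ a ∷ q`, the rotation is `q ++ p ∷ʳ a` and the successor of `a` is its
-- first entry: it lies in `q`, else in `p`, else it is `a`. These cases are the constructors of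
-- `CycNext`.
follows⇒cycNext : {L : List A} {a b : A} → Follows L a b → CycNext L a b
follows⇒cycNext (zs , ws , r , eq) with rotation-last zs r
follows⇒cycNext (_ , ws , r , refl) | [] , [] , refl , refl = single refl refl
follows⇒cycNext (_ , ws , r , refl) | b ∷ p , [] , refl , refl = wrap p refl
follows⇒cycNext (_ , ws , r , refl) | p , b ∷ q , refl , refl = inner p q refl

follows-functional : {L : List A} {a b b′ : A} → Unique L → Follows L a b → Follows L a b′ → b ≡ b′
follows-functional u (zs , ws , r , eq) (zs′ , ws′ , r′ , eq′)
  with rotation-last zs r | rotation-last zs′ r′
... | p , q , refl , refl | p′ , q′ , eL , refl with unique-split p p′ u eL
... | refl , refl = ∷-injectiveˡ (trans (sym eq) eq′)

∈⇒follows : {L : List A} {a : A} → a ∈ L → ∃ (Follows L a)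
∈⇒follows {a = a} a∈ with ∈-∃++ a∈
... | p , q , refl with q ++ p in eq
... | [] = a , [] , [] , (p ∷ʳ a , q , sym (++-assoc p [ a ] q) , trans (cong (_∷ʳ a) (sym eq)) (++-assoc q p [ a ])) , refl
... | b ∷ ws = b , b ∷ ws , _ , (p ∷ʳ a , q , sym (++-assoc p [ a ] q) , trans (cong (_∷ʳ a) (sym eq)) (++-assoc q p [ a ])) , refl

follows⇒∈ : {L : List A} {a b : A} → Follows L a b → a ∈ L
follows⇒∈ (zs , ws , r , eq) = rotation-∈ (rotation-sym r) (∈-++⁺ʳ zs (here refl))

rotation⇒↭ : {xs ys : List A} → Rotation xs ys → xs ↭ ys
rotation⇒↭ (as , bs , refl , refl) = ++-comm as bs

Unique-resp-↭ : {xs ys : List A} → xs ↭ ys → Unique xs → Unique ys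
Unique-resp-↭ {A} p = Perm.Unique-resp-↭ (setoid A) (↭⇒↭ₛ p)

-- Rotor turns at a single vertex

module Rotor (D : RibbonDigraph) where
  open RibbonDigraph D

  deg : Fin n → ℕ
  deg v = length (outEdges v)

  outOrder↭outEdges : ∀ v → outOrder D v ↭ outEdges v
  outOrder↭outEdges v = ↭-trans (mapMaybe-↭ (isOut D) (rot-ends v)) (↭-reflexive (begin
    mapMaybe (isOut D) (map inj₁ (outEdges v) ++ map inj₂ (inEdges v))
      ≡⟨ mapMaybe-++ (isOut D) (map inj₁ (outEdges v)) _ ⟩
    mapMaybe (isOut D) (map inj₁ (outEdges v)) ++ mapMaybe (isOut D) (map inj₂ (inEdges v))
      ≡⟨ cong₂ _++_ (mapMaybe-map-retract (λ _ → refl) (outEdges v))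
                    (mapMaybe-map-none (λ _ → refl) (inEdges v)) ⟩
    outEdges v ++ []
      ≡⟨ ++-identityʳ _ ⟩
    outEdges v ∎))
    where open ≡-Reasoning

  outOrder-unique : ∀ v → Unique (outOrder D v)
  outOrder-unique v = Unique-resp-↭ (↭-sym (outOrder↭outEdges v))
    (Unique.filter⁺ (λ e → tail e ≟ v) (Unique.allFin⁺ m))

  ∈-outOrder : ∀ {e v} → tail e ≡ v → e ∈ outOrder D v
  ∈-outOrder {e} {v} p = ∈-resp-↭ (↭-sym (outOrder↭outEdges v))
    (∈-filter⁺ (λ e → tail e ≟ v) (∈-allFin e) p)

  outOrder-tail : ∀ {e v} → e ∈ outOrder D v → tail e ≡ v
  outOrder-tail {e} {v} e∈ =
    proj₂ (∈-filter⁻ (λ e → tail e ≟ v) {xs = allFin m} (∈-resp-↭ (outOrder↭outEdges v) e∈))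

  deg-positive : ∀ {e v} → tail e ≡ v → 1 ℕ.≤ deg v
  deg-positive {e} {v} p = ∈-length (∈-filter⁺ (λ e → tail e ≟ v) (∈-allFin e) p)

  abstract
    -- The function `nextout`, with the vertex read off as the tail of `e`. It is opaque and
    -- accessible through `next-follows` only.
    next : Fin m → Fin m
    next e = proj₁ (∈⇒follows (∈-outOrder {e} refl))

    next-follows : ∀ e → Follows (outOrder D (tail e)) e (next e)
    next-follows e = proj₂ (∈⇒follows (∈-outOrder {e} refl))

  follows⇒tail : ∀ {v e f} → Follows (outOrder D v) e f → tail e ≡ v
  follows⇒tail p = outOrder-tail (follows⇒∈ p)

  follows⇒next : ∀ {v e f} → Follows (outOrder D v) e f → next e ≡ f
  follows⇒next {e = e} p with refl ← follows⇒tail p =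
    follows-functional (outOrder-unique _) (next-follows e) p

  tail-next : ∀ e → tail (next e) ≡ tail e
  tail-next e with zs , ws , r , eq ← next-follows e =
    outOrder-tail (rotation-∈ (rotation-sym (subst (Rotation _) eq r)) (here refl))

  advance : ℕ → Fin m → Fin m
  advance zero    e = e
  advance (suc k) e = advance k (next e)

  -- The edges along which `k` routings send chips. A routing advances the rotor before the chip
  -- moves, so the initial rotor `e` is left out and the final one is included.
  orbit : ℕ → Fin m → List (Fin m)
  orbit zero    e = []
  orbit (suc k) e = next e ∷ orbit k (next e)

  advance-+ : ∀ j k e → advance (j ℕ.+ k) e ≡ advance k (advance j e)
  advance-+ zero    k e = refl
  advance-+ (suc j) k e = advance-+ j k (next e)

  tail-advance : ∀ k e → tail (advance k e) ≡ tail e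
  tail-advance zero    e = refl
  tail-advance (suc k) e = trans (tail-advance k (next e)) (tail-next e)

  orbit-+ : ∀ j k e → orbit (j ℕ.+ k) e ≡ orbit j e ++ orbit k (advance j e)
  orbit-+ zero    k e = refl
  orbit-+ (suc j) k e = cong (next e ∷_) (orbit-+ j k (next e))

  orbit-∷ʳ : ∀ k e → orbit (suc k) e ≡ orbit k e ∷ʳ advance (suc k) e
  orbit-∷ʳ zero    e = refl
  orbit-∷ʳ (suc k) e = cong (next e ∷_) (orbit-∷ʳ k (next e))

  length-orbit : ∀ k e → length (orbit k e) ≡ k
  length-orbit zero    e = refl
  length-orbit (suc k) e = cong suc (length-orbit k (next e))

  ∈-orbit : ∀ k {e f} → f ∈ orbit k e → ∃ λ j → advance j e ≡ f
  ∈-orbit (suc k) (here refl) = 1 , refl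
  ∈-orbit (suc k) (there f∈) with j , p ← ∈-orbit k f∈ = suc j , p

  -- The entries already passed accumulate in the prefix `p`. Once `l` is exhausted, the last step
  -- wraps around to the first entry `c` of the whole list.
  orbit-rotation : ∀ {v c ws} p a l → Rotation (outOrder D v) ((p ∷ʳ a) ++ l) →
    (p ∷ʳ a) ++ l ≡ c ∷ ws → orbit (suc (length l)) a ≡ l ∷ʳ c
  orbit-rotation {v} {c} {ws} p a [] r eq = cong [_] (follows⇒next
    (p , ws , subst (Rotation _) (++-identityʳ (p ∷ʳ a)) r , trans (sym (++-identityʳ (p ∷ʳ a))) eq))
  orbit-rotation {v} {c} {ws} p a (b ∷ l) r eq = cong₂ _∷_ next-a≡b
    (trans (cong (orbit (suc (length l))) next-a≡b)
      (orbit-rotation (p ∷ʳ a) b l (subst (Rotation (outOrder D v)) (sym assoc) r) (trans assoc eq)))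
    where
    assoc : ((p ∷ʳ a) ∷ʳ b) ++ l ≡ (p ∷ʳ a) ++ b ∷ l
    assoc = ++-assoc (p ∷ʳ a) [ b ] l
    next-a≡b : next a ≡ b
    next-a≡b = follows⇒next {v} ((b ∷ l) ++ p , l ++ p ∷ʳ a ,
      subst (Rotation (outOrder D v)) (sym (++-assoc (b ∷ l) p [ a ]))
        (rotation-swap (p ∷ʳ a) (b ∷ l) r) , cong (b ∷_) (++-assoc l p [ a ]))

  -- This is `orbit-rotation` with empty prefix, on the rotation starting at `e`: the wrap-around
  -- edge is then `e` itself.
  orbit-deg : ∀ e → orbit (deg (tail e)) e ↭ outOrder D (tail e) × advance (deg (tail e)) e ≡ e
  orbit-deg e with as , bs , eq ← ∈-∃++ (∈-outOrder {e} refl) =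
    subst (λ k → orbit k e ↭ outOrder D (tail e) × advance k e ≡ e) (sym deg≡)
      ( ↭-trans (↭-reflexive orb) (↭-trans (↭-sym (++-comm [ e ] (bs ++ as))) (↭-sym (rotation⇒↭ rot-e)))
      , proj₂ (∷ʳ-injective (orbit (length (bs ++ as)) e) (bs ++ as) (trans (sym (orbit-∷ʳ _ e)) orb)) )
    where
    rot-e : Rotation (outOrder D (tail e)) (e ∷ bs ++ as)
    rot-e = as , e ∷ bs , eq , refl
    orb : orbit (suc (length (bs ++ as))) e ≡ (bs ++ as) ∷ʳ e
    orb = orbit-rotation [] e (bs ++ as) rot-e refl
    deg≡ : deg (tail e) ≡ suc (length (bs ++ as))
    deg≡ = trans (sym (↭-length (outOrder↭outEdges (tail e)))) (↭-length (rotation⇒↭ rot-e))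

  advance-*deg : ∀ c e → advance (c ℕ.* deg (tail e)) e ≡ e
  advance-*deg zero    e = refl
  advance-*deg (suc c) e = trans (advance-+ (deg (tail e)) (c ℕ.* deg (tail e)) e)
    (trans (cong (advance (c ℕ.* deg (tail e))) (proj₂ (orbit-deg e))) (advance-*deg c e))

  -- One `next` followed by `deg - 1` more steps is a full turn, hence the identity, so `next` can
  -- be undone. This later identifies the root rotors of two tours by their successors.
  next-injective : ∀ {e f} → tail e ≡ tail f → next e ≡ next f → e ≡ f
  next-injective {e} {f} t p = cancel (deg (tail e)) (deg-positive {e} refl) (proj₂ (orbit-deg e))
    (subst (λ v → advance (deg v) f ≡ f) (sym t) (proj₂ (orbit-deg f)))
    where
    cancel : ∀ d → 1 ℕ.≤ d → advance d e ≡ e → advance d f ≡ f → e ≡ f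
    cancel (suc d) _ q q′ = trans (sym q) (trans (cong (advance d) p) q′)

  -- Opaque because with-abstractions in later proofs would normalise the witness.
  abstract
    advance-transitive : ∀ {e f} → tail e ≡ tail f → ∃ λ j → advance j e ≡ f
    advance-transitive {e} {f} t =
      ∈-orbit (deg (tail e)) (∈-resp-↭ (↭-sym (proj₁ (orbit-deg e))) (∈-outOrder (sym t)))

  -- If advance j e ≡ e with 0 < j < deg, then e would occur twice in the full orbit.
  advance-fixed-< : ∀ j e → advance j e ≡ e → j ℕ.< deg (tail e) → j ≡ 0
  advance-fixed-< zero    e p j<d = refl
  advance-fixed-< (suc j) e p j<d = ⊥-elim (notUnique (∈ₗ , ∈ᵣ))
    where
    -- The offset 2 leaves two nonempty orbits, of lengths `suc j` and `suc k`, each ending at `e`.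
    k : ℕ
    k = deg (tail e) ∸ suc (suc j)
    deg≡ : deg (tail e) ≡ suc j ℕ.+ suc k
    deg≡ = trans (sym (ℕ.m+[n∸m]≡n j<d)) (sym (ℕ.+-suc (suc j) k))
    split : orbit (deg (tail e)) e ≡ orbit (suc j) e ++ orbit (suc k) e
    split = trans (cong (λ d → orbit d e) deg≡)
      (trans (orbit-+ (suc j) (suc k) e) (cong (λ f → orbit (suc j) e ++ orbit (suc k) f) p))
    p′ : advance (suc k) e ≡ e
    p′ = trans (cong (advance (suc k)) (sym p)) (trans (sym (advance-+ (suc j) (suc k) e))
      (trans (cong (λ d → advance d e) (sym deg≡)) (proj₂ (orbit-deg e))))
    last∈ : ∀ i → advance (suc i) e ≡ e → e ∈ orbit (suc i) e
    last∈ i q = subst (e ∈_) (sym (orbit-∷ʳ i e)) (∈-++⁺ʳ (orbit i e) (here (sym q)))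
    ∈ₗ : e ∈ orbit (suc j) e
    ∈ₗ = last∈ j p
    ∈ᵣ : e ∈ orbit (suc k) e
    ∈ᵣ = last∈ k p′
    disjoint : ∀ (xs : List (Fin m)) {ys} → Unique (xs ++ ys) → e ∈ xs → e ∈ ys → ⊥
    disjoint (x ∷ xs) (n ∷ u) (here refl) q = All.lookup n (∈-++⁺ʳ xs q) refl
    disjoint (x ∷ xs) (n ∷ u) (there p) q = disjoint xs u p q
    notUnique : e ∈ orbit (suc j) e × e ∈ orbit (suc k) e → ⊥
    notUnique (p , q) = disjoint (orbit (suc j) e) (subst Unique split
      (Unique-resp-↭ (↭-sym (proj₁ (orbit-deg e))) (outOrder-unique (tail e)))) p q

  hits : Fin n → List (Fin m) → ℕ
  hits u l = length (filter (λ e → head e ≟ u) l)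

  hits-++ : ∀ u l l′ → hits u (l ++ l′) ≡ hits u l ℕ.+ hits u l′
  hits-++ u l l′ = trans (cong length (filter-++ _ l l′)) (length-++ (filter _ l))

  -- Every full turn uses each out-edge once, so `c` turns send out the same chips as `c` firings.
  hits-orbit-*deg : ∀ c e u → hits u (orbit (c ℕ.* deg (tail e)) e) ≡ c ℕ.* nEdges D (tail e) u
  hits-orbit-*deg zero    e u = refl
  hits-orbit-*deg (suc c) e u = trans (cong (hits u) (orbit-+ (deg (tail e)) _ e))
    (trans (hits-++ u (orbit (deg (tail e)) e) _) (cong₂ ℕ._+_
      (↭-length (filter-↭ (λ e → head e ≟ u) (↭-trans (proj₁ (orbit-deg e)) (outOrder↭outEdges (tail e)))))
      (trans (cong (λ f → hits u (orbit (c ℕ.* deg (tail e)) f)) (proj₂ (orbit-deg e)))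
        (hits-orbit-*deg c e u))))

-- Finite sums of integers

*-distribˡ-sum : ∀ {n} (x : ℤ) (f : Fin n → ℤ) → x * sum f ≡ sum (λ i → x * f i)
*-distribˡ-sum = SemiringSum.*-distribˡ-sum ℤ.+-*-semiring

sum-zero : ∀ {n} {f : Fin n → ℤ} → (∀ v → f v ≡ + 0) → sum f ≡ + 0
sum-zero {n} p = trans (sum-cong-≗ p) (sum-replicate-zero n)

sum-single : ∀ {n} (f : Fin n → ℤ) v → (∀ u → u ≢ v → f u ≡ + 0) → sum f ≡ f v
sum-single f zero p = trans (cong (ℤ._+_ (f zero)) (sum-zero (λ u → p (suc u) λ ()))) (ℤ.+-identityʳ _)
sum-single f (suc v) p = trans (cong₂ _+_ (p zero λ ())
  (sum-single (f ∘ suc) v (λ u u≢v → p (suc u) (u≢v ∘ suc-injective)))) (ℤ.+-identityˡ _)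

sum-neg : ∀ {n} (f : Fin n → ℤ) → sum (λ v → - f v) ≡ - sum f
sum-neg {zero}  f = refl
sum-neg {suc n} f = trans (cong (ℤ._+_ (- f zero)) (sum-neg (f ∘ suc))) (sym (ℤ.neg-distrib-+ (f zero) _))

sum-minus : ∀ {n} (f g : Fin n → ℤ) → sum (λ v → f v - g v) ≡ sum f - sum g
sum-minus f g = trans (∑-distrib-+ f (λ v → - g v)) (cong (ℤ._+_ (sum f)) (sum-neg g))

sum-nonNeg : ∀ {n} {f : Fin n → ℤ} → (∀ v → + 0 ≤ f v) → + 0 ≤ sum f
sum-nonNeg {zero}  p = ℤ.≤-refl
sum-nonNeg {suc n} p = ℤ.+-mono-≤ (p zero) (sum-nonNeg (p ∘ suc))

term≤sum : ∀ {n} {f : Fin n → ℤ} → (∀ v → + 0 ≤ f v) → ∀ v → f v ≤ sum f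
term≤sum {f = f} p zero = subst (_≤ sum f) (ℤ.+-identityʳ (f zero))
  (ℤ.+-monoʳ-≤ (f zero) (sum-nonNeg (p ∘ suc)))
term≤sum {f = f} p (suc v) = subst (_≤ sum f) (ℤ.+-identityˡ (f (suc v)))
  (ℤ.+-mono-≤ (p zero) (term≤sum (p ∘ suc) v))

-- `ind` with natural values, so that `δ v` can also serve as the vector of one routing or one
-- firing at `v`.
δ : ∀ {n} → Fin n → Fin n → ℕ
δ a b with a ≟ b
... | yes _ = 1
... | no  _ = 0

δ-≡ : ∀ {n} {a b : Fin n} → a ≡ b → δ a b ≡ 1
δ-≡ {a = a} {b} p with a ≟ b
... | yes _ = refl
... | no ¬p = ⊥-elim (¬p p)

δ-≢ : ∀ {n} {a b : Fin n} → a ≢ b → δ a b ≡ 0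
δ-≢ {a = a} {b} ¬p with a ≟ b
... | yes p = ⊥-elim (¬p p)
... | no _ = refl

sum-δ : ∀ {n} (a : Fin n) (f : Fin n → ℤ) → sum (λ v → + δ a v * f v) ≡ f a
sum-δ a f = trans (sum-single _ a (λ u u≢a → cong (λ d → + d * f u) (δ-≢ (u≢a ∘ sym))))
  (trans (cong (λ d → + d * f a) (δ-≡ {a = a} refl)) (ℤ.*-identityˡ (f a)))

bounded : ∀ {n} (k : Fin n → ℕ) → ∃ λ N → ∀ v → k v ℕ.≤ N
bounded {zero}  k = 0 , λ ()
bounded {suc n} k with N , p ← bounded (k ∘ suc) = k zero ℕ.⊔ N , λ where
  zero    → ℕ.m≤m⊔n (k zero) N
  (suc v) → ℕ.≤-trans (p v) (ℕ.m≤n⊔m (k zero) N)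

-- Chip balance of routing and firing vectors

module Gain (D : RibbonDigraph) where
  open RibbonDigraph D
  open Rotor D

  ind≡δ : ∀ a b → ind D a b ≡ + δ a b
  ind≡δ a b with a ≟ b
  ... | yes _ = refl
  ... | no  _ = refl

  hits-∷ : ∀ u e l → hits u (e ∷ l) ≡ δ (head e) u ℕ.+ hits u l
  hits-∷ u e l with head e ≟ u
  ... | yes _ = refl
  ... | no  _ = refl

  WellFormed : Rotors D → Set
  WellFormed ρ = ∀ v → tail (ρ v) ≡ v

  -- Only the number of routings at each vertex enters: rotors at different vertices do not
  -- interact, so the order is immaterial (the abelian property).
  gain : Rotors D → (Fin n → ℕ) → Fin n → ℤ
  gain ρ k u = sum (λ v → + hits u (orbit (k v) (ρ v))) - + k u

  -- Minus the Laplacian of `D`, applied to `c`.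
  fireGain : (Fin n → ℕ) → Fin n → ℤ
  fireGain c u = sum (λ v → + (c v ℕ.* nEdges D v u)) - + (c u ℕ.* deg u)

  gain-cong : ∀ {ρ σ k l} → (∀ v → ρ v ≡ σ v) → (∀ v → k v ≡ l v) → ∀ u → gain ρ k u ≡ gain σ l u
  gain-cong p q u = cong₂ _-_
    (sum-cong-≗ (λ v → cong₂ (λ i e → + hits u (orbit i e)) (q v) (p v))) (cong +_ (q u))

  gain-zero : ∀ {ρ k} → (∀ v → k v ≡ 0) → ∀ u → gain ρ k u ≡ + 0
  gain-zero {ρ} p u = cong₂ _-_ (sum-zero (λ v → cong (λ i → + hits u (orbit i (ρ v))) (p v))) (cong +_ (p u))

  gain-+ : ∀ ρ j k u → gain ρ (λ v → j v ℕ.+ k v) u ≡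
    gain ρ j u + gain (λ v → advance (j v) (ρ v)) k u
  gain-+ ρ j k u = trans (cong (_- (+ (j u ℕ.+ k u))) (trans
      (sum-cong-≗ (λ v → cong +_ (trans (cong (hits u) (orbit-+ (j v) (k v) (ρ v)))
        (hits-++ u (orbit (j v) (ρ v)) _))))
      (∑-distrib-+ f g)))
    (rearrange (sum f) (sum g) (+ j u) (+ k u))
    where
    f g : Fin n → ℤ
    f v = + hits u (orbit (j v) (ρ v))
    g v = + hits u (orbit (k v) (advance (j v) (ρ v)))
    rearrange : ∀ a b c d → a + b - (c + d) ≡ a - c + (b - d)
    rearrange = solve-∀

  gain-δ : ∀ ρ v u → gain ρ (δ v) u ≡ + δ (head (next (ρ v))) u - + δ v u
  gain-δ ρ v u = cong (_- + δ v u) (trans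
    (sum-single _ v (λ w w≢v → cong (λ i → + hits u (orbit i (ρ w))) (δ-≢ (w≢v ∘ sym))))
    (trans (cong (λ i → + hits u (orbit i (ρ v))) (δ-≡ {a = v} refl))
      (cong +_ (trans (hits-∷ u (next (ρ v)) []) (ℕ.+-identityʳ _)))))

  gain-*deg : ∀ {ρ} → WellFormed ρ → ∀ c u → gain ρ (λ v → c v ℕ.* deg v) u ≡ fireGain c u
  gain-*deg {ρ} wf c u = cong (_- + (c u ℕ.* deg u)) (sum-cong-≗ λ v → cong +_
    (subst (λ w → hits u (orbit (c v ℕ.* deg w) (ρ v)) ≡ c v ℕ.* nEdges D w u) (wf v)
      (hits-orbit-*deg (c v) (ρ v) u)))

  advance-*deg′ : ∀ {ρ} → WellFormed ρ → ∀ c v → advance (c ℕ.* deg v) (ρ v) ≡ ρ v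
  advance-*deg′ {ρ} wf c v = subst (λ w → advance (c ℕ.* deg w) (ρ v) ≡ ρ v) (wf v) (advance-*deg c (ρ v))

  fireGain-cong : ∀ {c d} → (∀ v → c v ≡ d v) → ∀ u → fireGain c u ≡ fireGain d u
  fireGain-cong p u = cong₂ _-_ (sum-cong-≗ (λ v → cong (λ i → + (i ℕ.* nEdges D v u)) (p v)))
    (cong (λ i → + (i ℕ.* deg u)) (p u))

  fireGain-+ : ∀ c d u → fireGain (λ v → c v ℕ.+ d v) u ≡ fireGain c u + fireGain d u
  fireGain-+ c d u = trans (cong₂ _-_
      (trans (sum-cong-≗ (λ v → cong +_ (ℕ.*-distribʳ-+ (nEdges D v u) (c v) (d v))))
        (∑-distrib-+ f g))
      (cong +_ (ℕ.*-distribʳ-+ (deg u) (c u) (d u))))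
    (rearrange (sum f) (sum g) (+ (c u ℕ.* deg u)) (+ (d u ℕ.* deg u)))
    where
    f g : Fin n → ℤ
    f v = + (c v ℕ.* nEdges D v u)
    g v = + (d v ℕ.* nEdges D v u)
    rearrange : ∀ a b c d → a + b - (c + d) ≡ a - c + (b - d)
    rearrange = solve-∀

  fireGain-* : ∀ a c u → fireGain (λ v → a ℕ.* c v) u ≡ + a * fireGain c u
  fireGain-* a c u = trans (cong₂ _-_
      (trans (sum-cong-≗ (λ v → trans (cong +_ (ℕ.*-assoc a (c v) (nEdges D v u))) (ℤ.pos-* a _)))
        (sym (*-distribˡ-sum (+ a) (λ v → + (c v ℕ.* nEdges D v u)))))
      (trans (cong +_ (ℕ.*-assoc a (c u) (deg u))) (ℤ.pos-* a _)))
    (distrib (+ a) _ _)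
    where
    distrib : ∀ a b c → a * b - a * c ≡ a * (b - c)
    distrib = solve-∀

  fireGain-δ : ∀ v u → fireGain (δ v) u ≡ + nEdges D v u - + (δ v u ℕ.* deg u)
  fireGain-δ v u = cong (_- + (δ v u ℕ.* deg u)) (trans
    (sum-cong-≗ (λ w → ℤ.pos-* (δ v w) (nEdges D w u))) (sum-δ v (λ w → + nEdges D w u)))

  -- Grouping the edges by their tails. For `allFin m` it turns the sum of `nEdges D v u` over `v`
  -- into the in-degree of `u`.
  sum-hits-tail : ∀ l u → sum (λ v → + hits u (filter (λ e → tail e ≟ v) l)) ≡ + hits u l
  sum-hits-tail [] u = sum-zero {n} (λ v → refl)
  sum-hits-tail (e ∷ l) u = trans (sum-cong-≗ split) (trans (∑-distrib-+ (λ v → + δ (tail e) v * + δ (head e) u) _)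
    (trans (cong₂ _+_ (sum-δ (tail e) (λ _ → + δ (head e) u)) (sum-hits-tail l u))
      (cong +_ (sym (hits-∷ u e l)))))
    where
    split : ∀ v → + hits u (filter (λ e → tail e ≟ v) (e ∷ l)) ≡
      + δ (tail e) v * + δ (head e) u + + hits u (filter (λ e → tail e ≟ v) l)
    split v with tail e ≟ v
    ... | yes _ = trans (cong +_ (hits-∷ u e _))
      (cong (_+ + hits u (filter (λ e → tail e ≟ v) l)) (sym (ℤ.*-identityˡ (+ δ (head e) u))))
    ... | no  _ = refl

  -- If every vertex fires `N` times, `u` gains `N` chips per in-edge and loses `N` per out-edge;
  -- equal degrees make these cancel.
  fireGain-const : Eulerian D → ∀ N u → fireGain (λ _ → N) u ≡ + 0
  fireGain-const eul N u = trans (cong₂ _-_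
      (trans (sum-cong-≗ (λ v → ℤ.pos-* N (nEdges D v u)))
        (trans (sym (*-distribˡ-sum (+ N) (λ v → + nEdges D v u)))
          (trans (cong (+ N *_) (sum-hits-tail (allFin m) u)) (sym (ℤ.pos-* N _)))))
      (cong (λ d → + (N ℕ.* d)) (sym (eul u))))
    (ℤ.+-inverseʳ (+ (N ℕ.* hits u (allFin m))))

  weight : (Fin n → ℕ) → List (Fin m) → ℕ
  weight χ []      = 0
  weight χ (e ∷ l) = χ (head e) ℕ.+ weight χ l

  sum-hits : ∀ χ l → sum (λ u → + χ u * + hits u l) ≡ + weight χ l
  sum-hits χ [] = sum-zero (λ u → ℤ.*-zeroʳ (+ χ u))
  sum-hits χ (e ∷ l) = trans (sum-cong-≗ (λ u → trans (cong (λ h → + χ u * + h) (hits-∷ u e l))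
      (distrib (+ χ u) (+ δ (head e) u) (+ hits u l))))
    (trans (∑-distrib-+ (λ u → + δ (head e) u * + χ u) _)
      (cong₂ _+_ (sum-δ (head e) (λ u → + χ u)) (sum-hits χ l)))
    where
    distrib : ∀ a b c → a * (b + c) ≡ b * a + a * c
    distrib = solve-∀

  weight-≤ : ∀ χ → (∀ u → χ u ℕ.≤ 1) → ∀ l → weight χ l ℕ.≤ length l
  weight-≤ χ p []      = z≤n
  weight-≤ χ p (e ∷ l) = ℕ.+-mono-≤ (p (head e)) (weight-≤ χ p l)

  weight-++ : ∀ χ l l′ → weight χ (l ++ l′) ≡ weight χ l ℕ.+ weight χ l′
  weight-++ χ []      l′ = refl
  weight-++ χ (e ∷ l) l′ = trans (cong (χ (head e) ℕ.+_) (weight-++ χ l l′)) (sym (ℕ.+-assoc (χ (head e)) _ _))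

  weight-one : ∀ l → weight (λ _ → 1) l ≡ length l
  weight-one []      = refl
  weight-one (e ∷ l) = cong suc (weight-one l)

  -- Double counting by exchanging the sums: the weight of each chip's destination is credited to
  -- the vertex that sends it. Constant weight 1 gives conservation of chips; the indicator of a
  -- support measures leakage from it.
  sum-weighted-gain : ∀ χ ρ k → sum (λ u → + χ u * gain ρ k u) ≡
    sum (λ v → + weight χ (orbit (k v) (ρ v)) - + (χ v ℕ.* k v))
  sum-weighted-gain χ ρ k = begin
    sum (λ u → + χ u * gain ρ k u)
      ≡⟨ sum-cong-≗ (λ u → distrib (+ χ u) _ (+ k u)) ⟩
    sum (λ u → + χ u * sum (λ v → + h u v) - + χ u * + k u)
      ≡⟨ sum-minus _ (λ u → + χ u * + k u) ⟩
    sum (λ u → + χ u * sum (λ v → + h u v)) - sum (λ u → + χ u * + k u)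
      ≡⟨ cong₂ _-_ (trans (sum-cong-≗ (λ u → *-distribˡ-sum (+ χ u) (λ v → + h u v)))
           (∑-comm (λ u v → + χ u * + h u v))) (sum-cong-≗ (λ u → sym (ℤ.pos-* (χ u) (k u)))) ⟩
    sum (λ v → sum (λ u → + χ u * + h u v)) - sum (λ u → + (χ u ℕ.* k u))
      ≡⟨ cong (_- sum (λ u → + (χ u ℕ.* k u))) (sum-cong-≗ (λ v → sum-hits χ (orbit (k v) (ρ v)))) ⟩
    sum (λ v → + weight χ (orbit (k v) (ρ v))) - sum (λ u → + (χ u ℕ.* k u))
      ≡⟨ sum-minus _ (λ u → + (χ u ℕ.* k u)) ⟨
    sum (λ v → + weight χ (orbit (k v) (ρ v)) - + (χ v ℕ.* k v)) ∎
    where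
    open ≡-Reasoning
    h : Fin n → Fin n → ℕ
    h u v = hits u (orbit (k v) (ρ v))
    distrib : ∀ a b c → a * (b - c) ≡ a * b - a * c
    distrib = solve-∀

  sum-gain : ∀ ρ k → sum (gain ρ k) ≡ + 0
  sum-gain ρ k = trans (sum-cong-≗ (λ u → sym (ℤ.*-identityˡ (gain ρ k u))))
    (trans (sum-weighted-gain (λ _ → 1) ρ k) (sum-zero (λ v → trans
      (cong₂ (λ a b → + a - + b) (trans (weight-one (orbit (k v) (ρ v))) (length-orbit (k v) (ρ v))) (ℕ.*-identityˡ (k v)))
      (ℤ.+-inverseʳ (+ k v)))))

  -- Chips leaving the support S of k are not replaced, so if S loses none in total then every
  -- routed chip stays in S.
  support-closed : ∀ ρ k → (∀ u → k u ≢ 0 → + 0 ≤ gain ρ k u) →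
    ∀ v → k v ≢ 0 → k (head (advance (k v) (ρ v))) ≢ 0
  support-closed ρ k nonNeg v kv≢0 = last-in-support (k v) kv≢0 full
    where
    -- The indicator function of the support of `k`.
    χ : Fin n → ℕ
    χ u = k u ℕ.⊓ 1
    χ*k : ∀ u → χ u ℕ.* k u ≡ k u
    χ*k u with k u
    ... | zero  = refl
    ... | suc i = cong suc (trans (cong (λ a → i ℕ.+ a ℕ.* suc i) (ℕ.⊓-zeroʳ i)) (ℕ.+-identityʳ i))
    χ≤1 : ∀ u → χ u ℕ.≤ 1
    χ≤1 u = ℕ.m⊓n≤n (k u) 1
    W : Fin n → ℕ
    W v = weight χ (orbit (k v) (ρ v))
    W≤ : ∀ v → W v ℕ.≤ k v
    W≤ v = subst (W v ℕ.≤_) (length-orbit (k v) (ρ v)) (weight-≤ χ χ≤1 (orbit (k v) (ρ v)))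
    -- The number of chips that `v` sends out of the support.
    deficit : Fin n → ℤ
    deficit v = + k v - + W v
    deficit≥0 : ∀ v → + 0 ≤ deficit v
    deficit≥0 v = ℤ.i≤j⇒0≤j-i (ℤ.+≤+ (W≤ v))
    weighted≥0 : ∀ u → + 0 ≤ + χ u * gain ρ k u
    weighted≥0 u with k u ℕ.≟ 0
    ... | yes p = ℤ.≤-reflexive (cong (λ i → + (i ℕ.⊓ 1) * gain ρ k u) (sym p))
    ... | no ¬p = subst (_≤ + χ u * gain ρ k u) (ℤ.*-zeroʳ (+ χ u))
      (ℤ.*-monoˡ-≤-nonNeg (+ χ u) (nonNeg u ¬p))
    flip : ∀ a b → a - b ≡ - (b - a)
    flip = solve-∀
    sum≡ : sum (λ u → + χ u * gain ρ k u) ≡ - sum deficit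
    sum≡ = trans (sum-weighted-gain χ ρ k) (trans
      (sum-cong-≗ (λ v → trans (cong (λ i → + W v - + i) (χ*k v)) (flip (+ W v) (+ k v))))
      (sum-neg deficit))
    sum-deficit≤0 : sum deficit ≤ + 0
    sum-deficit≤0 = ℤ.neg-cancel-≤ (subst (+ 0 ≤_) sum≡ (sum-nonNeg weighted≥0))
    full : k v ℕ.≤ W v
    full = ℤ.drop‿+≤+ (ℤ.i-j≤0⇒i≤j (ℤ.≤-trans (term≤sum deficit≥0 v) sum-deficit≤0))
    last-in-support : ∀ i → i ≢ 0 → i ℕ.≤ weight χ (orbit i (ρ v)) → k (head (advance i (ρ v))) ≢ 0
    last-in-support zero    i≢0 p q = i≢0 refl
    -- If the last edge left the support, the first `i` edges would carry weight at least `suc i`,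
    -- although each weighs at most 1.
    last-in-support (suc i) i≢0 p q = ℕ.<-irrefl refl (ℕ.≤-trans p (ℕ.≤-trans
      (ℕ.≤-reflexive (trans (cong (weight χ) (orbit-∷ʳ i (ρ v)))
        (trans (weight-++ χ (orbit i (ρ v)) _)
          (trans (cong (λ a → weight χ (orbit i (ρ v)) ℕ.+ (a ℕ.⊓ 1 ℕ.+ 0)) q) (ℕ.+-identityʳ _)))))
      (subst (weight χ (orbit i (ρ v)) ℕ.≤_) (length-orbit i (ρ v)) (weight-≤ χ χ≤1 (orbit i (ρ v))))))

-- Totals of vectors

total : ∀ {n} (k : Fin n → ℕ) → ∃ λ N → sum (λ v → + k v) ≡ + N
total {zero}  k = 0 , refl
total {suc n} k with N , p ← total (k ∘ suc) = k zero ℕ.+ N , cong (ℤ._+_ (+ k zero)) p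

-- Spends one unit at `v`. The inductions on the total in `fireGain⇒∼` and `legal-routing` descend
-- by it.
sum-remove-δ : ∀ {n N} (k : Fin n → ℕ) v → k v ≢ 0 → sum (λ u → + k u) ≡ + N →
  Σ (Fin n → ℕ) λ l → (∀ u → k u ≡ δ v u ℕ.+ l u) × ∃ λ M → N ≡ suc M × sum (λ u → + l u) ≡ + M
sum-remove-δ {n} {N} k v kv≢0 p = l , split , proj₁ (total l) , N≡ , proj₂ (total l)
  where
  δ≤ : ∀ u → δ v u ℕ.≤ k u
  δ≤ u with v ≟ u
  ... | yes refl = ℕ.n≢0⇒n>0 kv≢0
  ... | no  _    = z≤n
  l : Fin n → ℕ
  l u = k u ∸ δ v u
  split : ∀ u → k u ≡ δ v u ℕ.+ l u
  split u = sym (ℕ.m+[n∸m]≡n (δ≤ u))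
  N≡ : N ≡ suc (proj₁ (total l))
  N≡ = ℤ.+-injective (trans (sym p) (trans (sum-cong-≗ (λ u → cong +_ (split u)))
    (trans (∑-distrib-+ (λ u → + δ v u) (λ u → + l u)) (cong₂ _+_
      (trans (sum-cong-≗ (λ u → sym (ℤ.*-identityʳ (+ δ v u)))) (sum-δ v (λ _ → + 1)))
      (proj₂ (total l))))))

sum≡0⇒≡0 : ∀ {n} (k : Fin n → ℕ) → sum (λ v → + k v) ≡ + 0 → ∀ v → k v ≡ 0
sum≡0⇒≡0 k p v = ℕ.n≤0⇒n≡0 (ℤ.drop‿+≤+
  (ℤ.≤-trans (term≤sum {f = λ v → + k v} (λ _ → ℤ.+≤+ z≤n) v) (ℤ.≤-reflexive p)))

sumℤ≡sum : ∀ D x → sumℤ D x ≡ sum x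
sumℤ≡sum D x = lemma (RibbonDigraph.n D) (λ v → v)
  where
  lemma : ∀ k (f : Fin k → Fin (RibbonDigraph.n D)) →
    foldr _+_ (+ 0) (map x (tabulate f)) ≡ sum (λ i → x (f i))
  lemma zero    f = refl
  lemma (suc k) f = cong (ℤ._+_ (x (f zero))) (lemma k (f ∘ suc))

-- Equivalence of chip-and-rotor states

module Reach (D : RibbonDigraph) where
  open RibbonDigraph D
  open Rotor D
  open Gain D

  infix 4 _⇝_
  -- Linear equivalence, encoded by a routing vector instead of a sequence of routings. Chip counts
  -- may become negative, so every order of the routings is admissible and all orders yield the same
  -- state.
  record _⇝_ (s t : State D) : Set where
    constructor route
    field
      times  : Fin n → ℕ
      rotors : ∀ v → advance (times v) (proj₂ s v) ≡ proj₂ t v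
      chips  : ∀ u → proj₁ s u + gain (proj₂ s) times u ≡ proj₁ t u

  ⇝-reflexive : ∀ {x y ρ σ} → (∀ u → x u ≡ y u) → (∀ v → ρ v ≡ σ v) → (x , ρ) ⇝ (y , σ)
  ⇝-reflexive {x} {ρ = ρ} p q = route (λ _ → 0) q λ u →
    trans (cong (ℤ._+_ (x u)) (gain-zero {ρ} {λ _ → 0} (λ _ → refl) u)) (trans (ℤ.+-identityʳ (x u)) (p u))

  ⇝-trans : ∀ {s t r} → s ⇝ t → t ⇝ r → s ⇝ r
  ⇝-trans {x , ρ} {y , σ} (route j p q) (route k p′ q′) = route (λ v → j v ℕ.+ k v)
    (λ v → trans (advance-+ (j v) (k v) (ρ v)) (trans (cong (advance (k v)) (p v)) (p′ v)))
    (λ u → trans (cong (ℤ._+_ (x u)) (trans (gain-+ ρ j k u)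
        (cong (ℤ._+_ (gain ρ j u)) (gain-cong {k = k} p (λ _ → refl) u))))
      (trans (sym (ℤ.+-assoc (x u) (gain ρ j u) (gain σ k u)))
        (trans (cong (_+ gain σ k u) (q u)) (q′ u))))

  ⇝-wellFormed : ∀ {x y ρ σ} → WellFormed ρ → (x , ρ) ⇝ (y , σ) → WellFormed σ
  ⇝-wellFormed {ρ = ρ} wf (route k p _) v =
    trans (cong tail (sym (p v))) (trans (tail-advance (k v) (ρ v)) (wf v))

  -- `gain` depends on the rotors and the routing vector alone, not on the chips.
  ⇝-shift : ∀ {x y ρ σ} (z : Chips D) → (x , ρ) ⇝ (y , σ) →
    ((λ u → x u + z u) , ρ) ⇝ ((λ u → y u + z u) , σ)
  ⇝-shift {x} {ρ = ρ} z (route k p q) = route k p λ u →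
    trans (rearrange (x u) (z u) (gain ρ k u)) (cong (_+ z u) (q u))
    where
    rearrange : ∀ a b c → a + b + c ≡ a + c + b
    rearrange = solve-∀

  ⇝-sum : ∀ {x y ρ σ} → (x , ρ) ⇝ (y , σ) → sum y ≡ sum x
  ⇝-sum {x} {y} {ρ} (route k _ q) = trans (sum-cong-≗ (λ u → sym (q u)))
    (trans (∑-distrib-+ x (gain ρ k)) (trans (cong (ℤ._+_ (sum x)) (sum-gain ρ k)) (ℤ.+-identityʳ (sum x))))

  -- Routing every v a multiple of deg v times acts as the identity, so the missing part of such a
  -- round undoes k.
  ⇝-sym : Eulerian D → ∀ {x y ρ σ} → WellFormed ρ → (x , ρ) ⇝ (y , σ) → (y , σ) ⇝ (x , ρ)
  ⇝-sym eul {x} {y} {ρ} {σ} wf (route k p q) = route l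
    (λ v → trans (cong (advance (l v)) (sym (p v))) (trans (sym (advance-+ (k v) (l v) (ρ v)))
      (trans (cong (λ i → advance i (ρ v)) (k+l v)) (advance-*deg′ wf N v))))
    (λ u → begin
      y u + gain σ l u
        ≡⟨ cong₂ _+_ (sym (q u)) (gain-cong {k = l} (λ v → sym (p v)) (λ _ → refl) u) ⟩
      x u + gain ρ k u + gain (λ v → advance (k v) (ρ v)) l u
        ≡⟨ ℤ.+-assoc (x u) _ _ ⟩
      x u + (gain ρ k u + gain (λ v → advance (k v) (ρ v)) l u)
        ≡⟨ cong (ℤ._+_ (x u)) (gain-+ ρ k l u) ⟨
      x u + gain ρ (λ v → k v ℕ.+ l v) u
        ≡⟨ cong (ℤ._+_ (x u)) (trans (gain-cong {ρ} (λ _ → refl) k+l u)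
             (trans (gain-*deg wf (λ _ → N) u) (fireGain-const eul N u))) ⟩
      x u + + 0
        ≡⟨ ℤ.+-identityʳ (x u) ⟩
      x u ∎)
    where
    open ≡-Reasoning
    N : ℕ
    N = proj₁ (bounded k)
    -- `N` bounds `k` and the out-degrees are positive, so this subtraction does not truncate.
    l : Fin n → ℕ
    l v = N ℕ.* deg v ∸ k v
    k+l : ∀ v → k v ℕ.+ l v ≡ N ℕ.* deg v
    k+l v = ℕ.m+[n∸m]≡n (ℕ.≤-trans (proj₂ (bounded k) v)
      (ℕ.≤-trans (ℕ.≤-reflexive (sym (ℕ.*-identityʳ N))) (ℕ.*-monoʳ-≤ N (deg-positive (wf v)))))

  fire≡fireGain : ∀ v x u → fire D v x u ≡ x u + fireGain (δ v) u
  fire≡fireGain v x u = trans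
    (cong (λ i → x u - i + + nEdges D v u)
      (trans (cong (_* + deg v) (ind≡δ v u)) (trans (sym (ℤ.pos-* (δ v u) (deg v))) (cong +_ (δ-transport v u)))))
    (trans (rearrange (x u) (+ (δ v u ℕ.* deg u)) (+ nEdges D v u))
      (cong (ℤ._+_ (x u)) (sym (fireGain-δ v u))))
    where
    -- `fire` uses the degree of the fired vertex and `fireGain` that of `u`; they agree wherever
    -- `δ v u` is nonzero.
    δ-transport : ∀ v u → δ v u ℕ.* deg v ≡ δ v u ℕ.* deg u
    δ-transport v u with v ≟ u
    ... | yes refl = refl
    ... | no  _    = refl
    rearrange : ∀ a b c → a - b + c ≡ a + (c - b)
    rearrange = solve-∀

  -- Firing `v` is routing it `deg v` times, after which its rotor is back in place.
  ∼⇒⇝ : ∀ {x y ρ} → WellFormed ρ → _∼_ D x y → (x , ρ) ⇝ (y , ρ)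
  ∼⇒⇝ wf ε = ⇝-reflexive (λ _ → refl) (λ _ → refl)
  ∼⇒⇝ {x} {ρ = ρ} wf ((v , p) ◅ ps) = ⇝-trans
    (route (λ w → δ v w ℕ.* deg w) (λ w → advance-*deg′ wf (δ v w) w)
      (λ u → trans (cong (ℤ._+_ (x u)) (gain-*deg wf (δ v) u))
        (trans (sym (fire≡fireGain v x u)) (sym (p u)))))
    (∼⇒⇝ wf ps)

  -- The total must be positive because `y` is known only pointwise: the empty sequence would need
  -- equality of functions, whereas the last firing step absorbs a pointwise equality.
  fireGain⇒∼ : ∀ N c {x y} → sum (λ v → + c v) ≡ + suc N → (∀ u → y u ≡ x u + fireGain c u) → _∼_ D x y
  fireGain⇒∼ N c {x} {y} p q with any? (λ v → ¬? (c v ℕ.≟ 0))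
  ... | no none = ⊥-elim (case-zero (trans (sym p) (sum-zero (λ v → cong +_ (zero-at v)))))
    where
    zero-at : ∀ v → c v ≡ 0
    zero-at v with c v ℕ.≟ 0
    ... | yes z = z
    ... | no nz = ⊥-elim (none (v , nz))
    case-zero : + suc N ≡ + 0 → ⊥
    case-zero ()
  ... | yes (v , cv≢0) with sum-remove-δ c v cv≢0 p
  ... | l , split , M , refl , sum-l = last-or-more N sum-l
    where
    y≡ : ∀ u → y u ≡ fire D v x u + fireGain l u
    y≡ u = trans (q u) (trans (cong (ℤ._+_ (x u)) (trans (fireGain-cong split u) (fireGain-+ (δ v) l u)))
      (trans (sym (ℤ.+-assoc (x u) (fireGain (δ v) u) (fireGain l u)))
        (cong (_+ fireGain l u) (sym (fire≡fireGain v x u)))))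
    last-or-more : ∀ M → sum (λ u → + l u) ≡ + M → _∼_ D x y
    last-or-more zero    s = (v , λ u → trans (y≡ u) (trans
      (cong (ℤ._+_ (fire D v x u)) (cong₂ _-_
        (sum-zero (λ w → cong (λ i → + (i ℕ.* nEdges D w u)) (sum≡0⇒≡0 l s w)))
        (cong (λ i → + (i ℕ.* deg u)) (sum≡0⇒≡0 l s u))))
      (ℤ.+-identityʳ _))) ◅ ε
    last-or-more (suc M) s = (v , λ u → refl) ◅ fireGain⇒∼ M l s y≡

  routing⇒⇝ : ∀ {v s t} → Routing D v s t → s ⇝ t
  routing⇒⇝ {v} {x , ρ} {y , σ} (e , nx , σv , σ-other , y≡) = route (δ v) adv λ u → trans
      (cong (ℤ._+_ (x u)) (trans (gain-δ ρ v u) (cong₂ _-_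
        (trans (cong (λ f → + δ (head f) u) next≡) (sym (ind≡δ (head e) u))) (sym (ind≡δ v u)))))
      (trans (rearrange (x u) (ind D (head e) u) (ind D v u)) (sym (y≡ u)))
    where
    next≡ : next (ρ v) ≡ e
    next≡ = follows⇒next {v} (cycNext⇒follows nx)
    adv : ∀ w → advance (δ v w) (ρ w) ≡ σ w
    adv w with v ≟ w
    ... | yes refl = trans next≡ (sym σv)
    ... | no v≢w   = sym (σ-other w (v≢w ∘ sym))
    rearrange : ∀ a b c → a + (b - c) ≡ a - c + b
    rearrange = solve-∀

  legal⇒⇝ : ∀ {w s t} → Star (LegalAway D w) s t → s ⇝ t
  legal⇒⇝ ε = ⇝-reflexive (λ _ → refl) (λ _ → refl)
  legal⇒⇝ {s = s} (_◅_ {j = t} (v , _ , _ , r) rs) = ⇝-trans (routing⇒⇝ {v} {s} {t} r) (legal⇒⇝ rs)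

  legal-sink : ∀ {w s t} → Star (LegalAway D w) s t → proj₂ t w ≡ proj₂ s w
  legal-sink ε = refl
  legal-sink ((_ , v≢w , _ , (_ , _ , _ , other , _)) ◅ rs) = trans (legal-sink rs) (other _ (v≢w ∘ sym))

  turn : Fin n → ℕ → Rotors D → Rotors D
  turn v j ρ w = advance (j ℕ.* δ v w) (ρ w)

  turn-at : ∀ v j ρ → turn v j ρ v ≡ advance j (ρ v)
  turn-at v j ρ = cong (λ i → advance i (ρ v)) (trans (cong (j ℕ.*_) (δ-≡ {a = v} refl)) (ℕ.*-identityʳ j))

  turn-other : ∀ {v w} j ρ → w ≢ v → turn v j ρ w ≡ ρ w
  turn-other {v} {w} j ρ w≢v =
    cong (λ i → advance i (ρ w)) (trans (cong (j ℕ.*_) (δ-≢ (w≢v ∘ sym))) (ℕ.*-zeroʳ j))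

  -- Since the rotor at `v` is the same on both sides, turning it sends the same chips `g` on both
  -- sides, and these cancel. This removes the dependence on the out-edge chosen at the sink in
  -- `RotorAct`.
  ⇝-turn : Eulerian D → ∀ {x y ρ σ} v j → WellFormed ρ → ρ v ≡ σ v → (x , ρ) ⇝ (y , σ) →
    (x , turn v j ρ) ⇝ (y , turn v j σ)
  ⇝-turn eul {x} {y} {ρ} {σ} v j wf ρv≡σv r = ⇝-trans
    (⇝-reflexive (λ u → cancel (x u) (g u)) (λ _ → refl))
    (⇝-trans (⇝-shift (λ u → - g u) moved) (⇝-reflexive (λ u → sym (cancel (y u) (g u))) (λ _ → refl)))
    where
    g : Fin n → ℤ
    g = gain ρ (λ w → j ℕ.* δ v w)
    hits≡ : ∀ u w → + hits u (orbit (j ℕ.* δ v w) (σ w)) ≡ + hits u (orbit (j ℕ.* δ v w) (ρ w))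
    hits≡ u w with v ≟ w
    ... | yes refl = cong (λ e → + hits u (orbit (j ℕ.* 1) e)) (sym ρv≡σv)
    ... | no _ = trans (cong (λ i → + hits u (orbit i (σ w))) (ℕ.*-zeroʳ j))
                   (cong (λ i → + hits u (orbit i (ρ w))) (sym (ℕ.*-zeroʳ j)))
    turned : ∀ z τ → (∀ u → gain τ (λ w → j ℕ.* δ v w) u ≡ g u) →
      (z , τ) ⇝ ((λ u → z u + g u) , turn v j τ)
    turned z τ p = route (λ w → j ℕ.* δ v w) (λ _ → refl) λ u → cong (ℤ._+_ (z u)) (p u)
    moved : ((λ u → x u + g u) , turn v j ρ) ⇝ ((λ u → y u + g u) , turn v j σ)
    moved = ⇝-trans (⇝-sym eul wf (turned x ρ (λ _ → refl)))
      (⇝-trans r (turned y σ (λ u → cong (_- + (j ℕ.* δ v u)) (sum-cong-≗ (hits≡ u)))))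
    cancel : ∀ a b → a ≡ a + b + - b
    cancel = solve-∀

  -- As long as some vertex off the sink carries a chip, the abelian property lets us route it
  -- within the prescribed vector k; at the end only a closed support for k could remain.
  legal-routing : ∀ w (σ : Rotors D) →
    (∀ k → k w ≡ 0 → (∀ v → k v ≢ 0 → k (head (σ v)) ≢ 0) → ∀ v → k v ≡ 0) →
    ∀ N x ρ k → WellFormed ρ → sum (λ v → + k v) ≡ + N → k w ≡ 0 →
    (∀ u → u ≢ w → + 0 ≤ x u) →
    (∀ v → advance (k v) (ρ v) ≡ σ v) → (∀ u → u ≢ w → x u + gain ρ k u ≡ + 0) →
    Σ (Chips D) λ y → Σ (Rotors D) λ ρ′ → Star (LegalAway D w) (x , ρ) (y , ρ′) ×
      (∀ u → u ≢ w → y u ≡ + 0) × (∀ v → ρ′ v ≡ σ v)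
  legal-routing w σ acyclic N x ρ k wf sum-k kw≡0 x≥0 adv end
    with any? (λ v → ¬? (v ≟ w) ×-dec (+ 0 ℤ.<? x v))
  ... | no stuck = x , ρ , ε , x≡0 , λ v → trans (cong (λ i → advance i (ρ v)) (sym (k≡0 v))) (adv v)
    where
    x≡0 : ∀ u → u ≢ w → x u ≡ + 0
    x≡0 u u≢w = ℤ.≤-antisym (ℤ.≮⇒≥ (λ p → stuck (u , u≢w , p))) (x≥0 u u≢w)
    gain≡0 : ∀ u → k u ≢ 0 → + 0 ≤ gain ρ k u
    gain≡0 u ku≢0 = ℤ.≤-reflexive (sym (trans (sym (ℤ.+-identityˡ _))
      (trans (cong (_+ gain ρ k u) (sym (x≡0 u u≢w))) (end u u≢w))))
      where
      u≢w : u ≢ w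
      u≢w refl = ku≢0 kw≡0
    k≡0 : ∀ v → k v ≡ 0
    k≡0 = acyclic k kw≡0 (λ v kv≢0 →
      subst (λ e → k (head e) ≢ 0) (adv v) (support-closed ρ k gain≡0 v kv≢0))
  ... | yes (v , v≢w , xv>0) with sum-remove-δ k v kv≢0 sum-k
    where
    arrivals : Fin n → ℤ
    arrivals u = + hits v (orbit (k u) (ρ u))
    -- A vertex with no routings left can only gain chips, so its positive number of chips could not
    -- end at 0.
    kv≢0 : k v ≢ 0
    kv≢0 kv≡0 = ℤ.<-irrefl (sym (trans (cong (λ i → x v + (sum arrivals - + i)) (sym kv≡0)) (end v v≢w)))
      (ℤ.+-mono-<-≤ xv>0 (ℤ.≤-trans (sum-nonNeg {f = arrivals} (λ u → ℤ.+≤+ z≤n))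
        (ℤ.≤-reflexive (sym (ℤ.+-identityʳ (sum arrivals))))))
  ... | l , split , M , refl , sum-l
    with legal-routing w σ acyclic M x₁ ρ₁ l wf₁ sum-l lw≡0 x₁≥0 adv₁ end₁
    where
    e : Fin m
    e = next (ρ v)
    x₁ : Chips D
    x₁ u = x u - ind D v u + ind D (head e) u
    ρ₁ : Rotors D
    ρ₁ u = advance (δ v u) (ρ u)
    wf₁ : WellFormed ρ₁
    wf₁ u = trans (tail-advance (δ v u) (ρ u)) (wf u)
    lw≡0 : l w ≡ 0
    lw≡0 = trans (cong (ℕ._+ l w) (sym (δ-≢ v≢w))) (trans (sym (split w)) kw≡0)
    ind≥0 : ∀ a b → + 0 ≤ ind D a b
    ind≥0 a b = subst (+ 0 ≤_) (sym (ind≡δ a b)) (ℤ.+≤+ z≤n)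
    x₁≥0 : ∀ u → u ≢ w → + 0 ≤ x₁ u
    x₁≥0 u u≢w = ℤ.+-mono-≤ (ℤ.i≤j⇒0≤j-i ind≤) (ind≥0 (head e) u)
      where
      ind≤ : ind D v u ≤ x u
      ind≤ with v ≟ u
      ... | yes refl = ℤ.i<j⇒suc[i]≤j xv>0
      ... | no _ = x≥0 u u≢w
    adv₁ : ∀ u → advance (l u) (ρ₁ u) ≡ σ u
    adv₁ u = trans (sym (advance-+ (δ v u) (l u) (ρ u)))
      (trans (cong (λ i → advance i (ρ u)) (sym (split u))) (adv u))
    x₁≡ : ∀ u → x₁ u ≡ x u + gain ρ (δ v) u
    x₁≡ u = trans (cong₂ (λ a b → x u - a + b) (ind≡δ v u) (ind≡δ (head e) u))
      (trans (rearrange (x u) (+ δ v u) (+ δ (head e) u)) (cong (ℤ._+_ (x u)) (sym (gain-δ ρ v u))))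
      where
      rearrange : ∀ a b c → a - b + c ≡ a + (c - b)
      rearrange = solve-∀
    end₁ : ∀ u → u ≢ w → x₁ u + gain ρ₁ l u ≡ + 0
    end₁ u u≢w = trans (cong (_+ gain ρ₁ l u) (x₁≡ u))
      (trans (ℤ.+-assoc (x u) (gain ρ (δ v) u) (gain ρ₁ l u))
        (trans (cong (ℤ._+_ (x u)) (sym (trans (gain-cong {ρ} (λ _ → refl) split u) (gain-+ ρ (δ v) l u))))
          (end u u≢w)))
  ... | y , ρ′ , path , y≡0 , ρ′≡σ = y , ρ′ , (v , v≢w , xv>0 , next (ρ v) ,
      subst (λ a → NextOut D a (ρ v) (next (ρ v))) (wf v) (follows⇒cycNext (next-follows (ρ v))) ,
      cong (λ i → advance i (ρ v)) (δ-≡ {a = v} refl) ,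
      (λ u u≢v → cong (λ i → advance i (ρ u)) (δ-≢ (u≢v ∘ sym))) ,
      (λ u → refl)) ◅ path , y≡0 , ρ′≡σ

-- Firing vectors supplying chips away from a sink

module Supply (D : RibbonDigraph) where
  open RibbonDigraph D
  open Rotor D
  open Gain D

  fireGain-nothing : ∀ u → fireGain (λ _ → 0) u ≡ + 0
  fireGain-nothing u = trans (ℤ.+-identityʳ _) (sum-zero {n} (λ _ → refl))

  -- The sink `w` is exempt from both demands. Hence the zero vector supplies `w`, which starts the
  -- propagation along edges.
  Supplies : Fin n → (Fin n → ℕ) → Fin n → Set
  Supplies w c p = (∀ y → y ≢ w → + 0 ≤ fireGain c y) × (p ≢ w → + 1 ≤ fireGain c p)

  -- Repeating `c` as often as the out-degree of `tail e` collects enough chips there to pay for one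
  -- firing of `tail e`, which sends at least one chip to `head e`.
  supplies-step : ∀ w e → ∃ (λ c → Supplies w c (tail e)) → ∃ (λ c → Supplies w c (head e))
  supplies-step w e (c , nonNeg , pos) = c′ ,
    (λ y y≢w → subst (+ 0 ≤_) (sym (c′≡ y)) (ℤ.+-mono-≤ (remainder≥0 y y≢w) (ℤ.+≤+ z≤n))) ,
    (λ h≢w → subst (+ 1 ≤_) (sym (c′≡ (head e)))
      (ℤ.+-mono-≤ (remainder≥0 (head e) h≢w) (ℤ.+≤+ (∈-length (∈-filter⁺ (λ f → head f ≟ head e)
        (∈-filter⁺ (λ f → tail f ≟ tail e) (∈-allFin e) refl) refl)))))
    where
    D₀ : ℕ
    D₀ = deg (tail e)
    c′ : Fin n → ℕ
    c′ v = D₀ ℕ.* c v ℕ.+ δ (tail e) v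
    remainder : Fin n → ℤ
    remainder y = + D₀ * fireGain c y - + (δ (tail e) y ℕ.* deg y)
    c′≡ : ∀ y → fireGain c′ y ≡ remainder y + + nEdges D (tail e) y
    c′≡ y = trans (fireGain-+ (λ v → D₀ ℕ.* c v) (δ (tail e)) y)
      (trans (cong₂ _+_ (fireGain-* D₀ c y) (fireGain-δ (tail e) y))
        (rearrange (+ D₀ * fireGain c y) (+ nEdges D (tail e) y) (+ (δ (tail e) y ℕ.* deg y))))
      where
      rearrange : ∀ a b c → a + (b - c) ≡ a - c + b
      rearrange = solve-∀
    remainder≥0 : ∀ y → y ≢ w → + 0 ≤ remainder y
    remainder≥0 y y≢w with tail e ≟ y
    ... | yes refl = ℤ.i≤j⇒0≤j-i (subst (_≤ + D₀ * fireGain c y)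
      (trans (ℤ.*-identityʳ (+ D₀)) (cong +_ (sym (ℕ.*-identityˡ D₀))))
      (ℤ.*-monoˡ-≤-nonNeg (+ D₀) (pos y≢w)))
    ... | no  _ = subst (+ 0 ≤_) (sym (ℤ.+-identityʳ _)) (subst (_≤ + D₀ * fireGain c y) (ℤ.*-zeroʳ (+ D₀))
      (ℤ.*-monoˡ-≤-nonNeg (+ D₀) (nonNeg y y≢w)))

-- Last exits in a list of edges

module LastOut (D : RibbonDigraph) where
  open RibbonDigraph D

  -- `d` is the value if no edge of the list leaves `v`; in recursive calls it holds the latest exit
  -- seen so far.
  lastOut : List (Fin m) → Fin n → Fin m → Fin m
  lastOut []      v d = d
  lastOut (e ∷ r) v d with tail e ≟ v
  ... | yes _ = lastOut r v e
  ... | no  _ = lastOut r v d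

  lastOut-∷ʳ-≡ : ∀ r e d → lastOut (r ∷ʳ e) (tail e) d ≡ e
  lastOut-∷ʳ-≡ [] e d with tail e ≟ tail e
  ... | yes _ = refl
  ... | no ¬p = ⊥-elim (¬p refl)
  lastOut-∷ʳ-≡ (f ∷ r) e d with tail f ≟ tail e
  ... | yes _ = lastOut-∷ʳ-≡ r e f
  ... | no  _ = lastOut-∷ʳ-≡ r e d

  lastOut-∷ʳ-≢ : ∀ r e {v} d → tail e ≢ v → lastOut (r ∷ʳ e) v d ≡ lastOut r v d
  lastOut-∷ʳ-≢ [] e {v} d ¬p with tail e ≟ v
  ... | yes p = ⊥-elim (¬p p)
  ... | no _ = refl
  lastOut-∷ʳ-≢ (f ∷ r) e {v} d ¬p with tail f ≟ v
  ... | yes _ = lastOut-∷ʳ-≢ r e f ¬p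
  ... | no  _ = lastOut-∷ʳ-≢ r e d ¬p

  lastOut-∷-≢ : ∀ r e {v} d → tail e ≢ v → lastOut (e ∷ r) v d ≡ lastOut r v d
  lastOut-∷-≢ r e {v} d ¬p with tail e ≟ v
  ... | yes p = ⊥-elim (¬p p)
  ... | no _ = refl

  lastOut-∷-≡ : ∀ r e d → lastOut (e ∷ r) (tail e) d ≡ lastOut r (tail e) e
  lastOut-∷-≡ r e d with tail e ≟ tail e
  ... | yes _ = refl
  ... | no ¬p = ⊥-elim (¬p refl)

  tail-lastOut : ∀ r {v d} → tail d ≡ v → tail (lastOut r v d) ≡ v
  tail-lastOut [] p = p
  tail-lastOut (e ∷ r) {v} p with tail e ≟ v
  ... | yes q = tail-lastOut r q
  ... | no  _ = tail-lastOut r p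

  -- The default in front keeps the list nonempty, so it has a last entry even if `v` has no exit in
  -- `r`.
  lastOut-filter : ∀ r v d → ∃ λ zs → d ∷ filter (λ e → tail e ≟ v) r ≡ zs ∷ʳ lastOut r v d
  lastOut-filter [] v d = [] , refl
  lastOut-filter (e ∷ r) v d with tail e ≟ v
  ... | yes _ with zs , p ← lastOut-filter r v e = d ∷ zs , cong (d ∷_) p
  ... | no  _ = lastOut-filter r v d

  lastOut-unused : ∀ r {v} d → All (λ g → tail g ≢ v) r → lastOut r v d ≡ d
  lastOut-unused [] d [] = refl
  lastOut-unused (e ∷ r) d (p ∷ ps) = trans (lastOut-∷-≢ r e d p) (lastOut-unused r d ps)

  lastOut-split : ∀ pre f post d → All (λ g → tail g ≢ tail f) post →
    lastOut (pre ++ f ∷ post) (tail f) d ≡ f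
  lastOut-split [] f post d ps = trans (lastOut-∷-≡ post f d) (lastOut-unused post f ps)
  lastOut-split (e ∷ pre) f post d ps with tail e ≟ tail f
  ... | yes _ = lastOut-split pre f post e ps
  ... | no  _ = lastOut-split pre f post d ps

  lastOut-view : ∀ r v d → All (λ g → tail g ≢ v) r ⊎
    ∃₂ λ pre post → r ≡ pre ++ lastOut r v d ∷ post × All (λ g → tail g ≢ v) post
  lastOut-view [] v d = inj₁ []
  lastOut-view (e ∷ r) v d with tail e ≟ v
  lastOut-view (e ∷ r) v d | yes p with lastOut-view r v e
  ... | inj₁ all = inj₂ ([] , r , cong (_∷ r) (sym (lastOut-unused r e all)) , all)
  ... | inj₂ (pre , post , q , all) = inj₂ (e ∷ pre , post , cong (e ∷_) q , all)
  lastOut-view (e ∷ r) v d | no ¬p with lastOut-view r v d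
  ... | inj₁ all = inj₁ (¬p ∷ all)
  ... | inj₂ (pre , post , q , all) = inj₂ (e ∷ pre , post , cong (e ∷_) q , all)

-- Compatible tours and their rotor states

module Tour (D : RibbonDigraph) (t : List (Fin (RibbonDigraph.m D))) (tour : CompatibleTour D t) where
  open RibbonDigraph D
  open Rotor D
  open Gain D
  open Reach D
  open Supply D
  open LastOut D

  tour-∈ : ∀ {r} → Rotation t r → ∀ e → e ∈ r
  tour-∈ rot e = rotation-∈ rot (∈-resp-↭ (↭-sym (proj₁ (proj₁ tour))) (∈-allFin e))

  tour-follows : ∀ {e f} → Follows t e f → head e ≡ tail f
  tour-follows p = proj₂ (proj₁ tour) _ _ (follows⇒cycNext p)

  tour-head-tail : ∀ {zs e f ws} → Rotation t (zs ∷ʳ e) → zs ∷ʳ e ≡ f ∷ ws → head e ≡ tail f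
  tour-head-tail rot eq = tour-follows (_ , _ , rot , eq)

  -- The first edge of a path from `v` to `tail e₀` either leaves `v` or enters it; in the second
  -- case the tour continues from `v` by the successor of that edge.
  out-edge : WeaklyConnected D → Fin m → ∀ v → ∃ λ e → tail e ≡ v
  out-edge conn e₀ v with conn v (tail e₀)
  ... | ε = e₀ , refl
  ... | (e , inj₁ (p , _)) ◅ _ = e , p
  ... | (e , inj₂ (_ , p)) ◅ _ with ∈⇒follows (tour-∈ (rotation-refl t) e)
  ... | f , fol = f , trans (sym (tour-follows fol)) p

  -- Here compatibility enters. The exits from `tail e`, read from `e` on, form a rotation of the
  -- ribbon order that starts with `e` and ends with the last exit, so `e` is its successor.
  next-lastOut : ∀ {e rs} d → Rotation t (e ∷ rs) → next (lastOut (e ∷ rs) (tail e) d) ≡ e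
  next-lastOut {e} {rs} d (as , bs , p , q) = trans (cong next (lastOut-∷-≡ rs e d))
    (follows⇒next {tail e} (zs , filter out? rs ,
      rotation-trans (rotation-sym (proj₂ tour (tail e)))
        (filter out? as , filter out? bs , trans (cong (filter out?) p) (filter-++ out? as bs) ,
         trans (sym zs≡) (trans (sym filter-e) (trans (cong (filter out?) q) (filter-++ out? bs as)))) ,
      sym zs≡))
    where
    out? : ∀ f → Dec (tail f ≡ tail e)
    out? f = tail f ≟ tail e
    zs : List (Fin m)
    zs = proj₁ (lastOut-filter rs (tail e) e)
    zs≡ : e ∷ filter out? rs ≡ zs ∷ʳ lastOut rs (tail e) e
    zs≡ = proj₂ (lastOut-filter rs (tail e) e)
    filter-e : filter out? (e ∷ rs) ≡ e ∷ filter out? rs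
    filter-e = filter-accept out? refl

  -- The tour serves as a directed walk from the sink through all edges; `pre` is the part already
  -- walked, and `supplies-step` carries the supply across each edge.
  supplies-along : ∀ w pre e rs → Rotation t (pre ++ e ∷ rs) → ∃ (λ c → Supplies w c (tail e)) →
    ∀ {f} → f ∈ e ∷ rs → ∃ (λ c → Supplies w c (tail f))
  supplies-along w pre e rs rot s (here refl) = s
  supplies-along w pre e (g ∷ rs) rot s (there f∈) = supplies-along w (pre ∷ʳ e) g rs rot′
    (subst (λ v → ∃ (λ c → Supplies w c v))
      (tour-head-tail {g ∷ rs ++ pre} (subst (Rotation t) (sym (++-assoc (g ∷ rs) pre [ e ]))
        (rotation-swap (pre ∷ʳ e) (g ∷ rs) rot′)) refl)
      (supplies-step w e s)) f∈
    where
    rot′ : Rotation t ((pre ∷ʳ e) ++ g ∷ rs)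
    rot′ = subst (Rotation t) (sym (++-assoc pre [ e ] (g ∷ rs))) rot

  module _ (d : Rotors D) (wf-d : WellFormed d) where

    rotor : List (Fin m) → Rotors D
    rotor r v = lastOut r v (d v)

    wf-rotor : ∀ r → WellFormed (rotor r)
    wf-rotor r v = tail-lastOut r (wf-d v)

    tour-state : List (Fin m) → State D
    tour-state []      = (λ _ → + 0) , rotor []
    tour-state (e ∷ r) = (λ u → + δ (tail e) u) , rotor (e ∷ r)

    -- Routing the only chip turns the rotor at `tail e` to `e` and moves the chip to `head e`,
    -- where the tour continues. Moving `e` to the end of the word changes only the last exit from
    -- `tail e`, to `e`.
    tour-step : ∀ {e rs} → Rotation t (e ∷ rs) → tour-state (e ∷ rs) ⇝ tour-state (rs ∷ʳ e)
    tour-step {e} {rs} rot = subst (tour-state (e ∷ rs) ⇝_) state≡ (route (δ (tail e)) adv λ u →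
        trans (cong (ℤ._+_ (+ δ (tail e) u)) (trans (gain-δ (rotor (e ∷ rs)) (tail e) u)
            (cong (λ f → + δ (head f) u - + δ (tail e) u) next≡)))
          (cancel (+ δ (tail e) u) (+ δ (head e) u)))
      where
      cancel : ∀ a b → a + (b - a) ≡ b
      cancel = solve-∀
      next≡ : next (rotor (e ∷ rs) (tail e)) ≡ e
      next≡ = next-lastOut (d (tail e)) rot
      state≡ : ((λ u → + δ (head e) u) , rotor (rs ∷ʳ e)) ≡ tour-state (rs ∷ʳ e)
      state≡ with rs ∷ʳ e in eq
      ... | []     = ⊥-elim (case-nil rs eq)
        where
        case-nil : ∀ xs → xs ∷ʳ e ≡ [] → ⊥
        case-nil [] ()
        case-nil (_ ∷ _) ()
      ... | f ∷ ws = cong (λ v → (λ u → + δ v u) , rotor (f ∷ ws)) (tour-head-tail (rotation-step rot) eq)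
      adv : ∀ v → advance (δ (tail e) v) (rotor (e ∷ rs) v) ≡ rotor (rs ∷ʳ e) v
      adv v with tail e ≟ v in eq
      ... | yes refl = trans (cong next (sym (lastOut-∷-≡ rs e e))) (trans (next-lastOut e rot)
          (sym (lastOut-∷ʳ-≡ rs e (d (tail e)))))
      ... | no  ¬p   = sym (lastOut-∷ʳ-≢ rs e (d v) ¬p)

    tour-reach : ∀ as bs → Rotation t (as ++ bs) → tour-state (as ++ bs) ⇝ tour-state (bs ++ as)
    tour-reach [] bs rot = subst (λ r → tour-state bs ⇝ tour-state r) (sym (++-identityʳ bs))
      (⇝-reflexive (λ _ → refl) (λ _ → refl))
    tour-reach (e ∷ as) bs rot = ⇝-trans
      (subst (λ r → tour-state (e ∷ as ++ bs) ⇝ tour-state r) (++-assoc as bs [ e ]) (tour-step rot))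
      (subst (λ r → tour-state (as ++ bs ∷ʳ e) ⇝ tour-state r) (++-assoc bs [ e ] as)
        (tour-reach as (bs ∷ʳ e) (subst (Rotation t) (++-assoc as bs [ e ]) (rotation-step rot))))

    wf-tour-state : ∀ r → WellFormed (proj₂ (tour-state r))
    wf-tour-state []      = wf-rotor []
    wf-tour-state (e ∷ r) = wf-rotor (e ∷ r)

    tour-connected : Eulerian D → ∀ {r s} → Rotation t r → Rotation t s → tour-state r ⇝ tour-state s
    tour-connected eul rot rot′ = ⇝-trans (⇝-sym eul (wf-tour-state t) (from-t rot)) (from-t rot′)
      where
      from-t : ∀ {r} → Rotation t r → tour-state t ⇝ tour-state r
      from-t (as , bs , p , q) = subst₂ (λ r s → tour-state r ⇝ tour-state s) (sym p) (sym q)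
        (tour-reach as bs (subst (Rotation t) p (rotation-refl t)))

    -- The edge `f` itself occurs in the tour, so `tail f` has an exit and the default value is not
    -- reached there.
    lastOut⇔rotor : ∀ {r} → Rotation t r → ∀ w f →
      LastOut D w r f ⇔ (¬ tail f ≡ w × rotor r (tail f) ≡ f)
    lastOut⇔rotor {r} rot w f = mk⇔
      (λ { (f≢w , pre , post , refl , all) → f≢w , lastOut-split pre f post (d (tail f)) all })
      (λ { (f≢w , p) → f≢w , split p (lastOut-view r (tail f) (d (tail f))) })
      where
      split : rotor r (tail f) ≡ f → All (λ g → tail g ≢ tail f) r ⊎
        (∃₂ λ pre post → r ≡ pre ++ rotor r (tail f) ∷ post × All (λ g → tail g ≢ tail f) post) →
        ∃₂ λ pre post → r ≡ pre ++ f ∷ post × All (λ g → tail g ≢ tail f) post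
      split p (inj₁ all) = ⊥-elim (All.lookup all (tour-∈ rot f) refl)
      split p (inj₂ (pre , post , q , all)) = pre , post , trans q (cong (λ g → pre ++ g ∷ post) p) , all

    -- Within S the last exits would advance along the tour without ever reaching its end, which
    -- returns to the sink.
    rotor-acyclic : ∀ {e₀ rs} → Rotation t (e₀ ∷ rs) → (S : Fin n → Set) → (∀ v → Dec (S v)) →
      ¬ S (tail e₀) → (∀ v → S v → S (head (rotor (e₀ ∷ rs) v))) → ∀ v → ¬ S v
    rotor-acyclic {e₀} {rs} rot S S? ¬Sw closed v Sv = All.lookup (outside [] (e₀ ∷ rs) refl)
      (tour-∈ rot (d v)) (subst S (sym (wf-d v)) Sv)
      where
      outside : ∀ pre post → pre ++ post ≡ e₀ ∷ rs → All (λ e → ¬ S (tail e)) post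
      outside pre [] eq = []
      outside pre (f ∷ post) eq = f-outside ∷ rest
        where
        rest : All (λ e → ¬ S (tail e)) post
        rest = outside (pre ∷ʳ f) post (trans (++-assoc pre [ f ] post) eq)
        rot-f : Rotation t ((post ++ pre) ∷ʳ f)
        rot-f = subst (Rotation t) (sym (++-assoc post pre [ f ]))
          (rotation-swap (pre ∷ʳ f) post (subst (Rotation t)
            (sym (trans (++-assoc pre [ f ] post) eq)) rot))
        head-outside : ∀ {post} → All (λ e → ¬ S (tail e)) post → pre ++ f ∷ post ≡ e₀ ∷ rs →
          Rotation t ((post ++ pre) ∷ʳ f) → ¬ S (head f)
        head-outside [] eq r = subst (λ v → ¬ S v) (sym (tour-head-tail r eq)) ¬Sw
        head-outside {g ∷ post} (¬Sg ∷ _) eq r =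
          subst (λ v → ¬ S v) (sym (tour-head-tail {(g ∷ post) ++ pre} r refl)) ¬Sg
        f-outside : ¬ S (tail f)
        -- No edge of `post` leaves `S`, so if `tail f` were in `S`, then `f` would be its last exit
        -- and `head f` would lie in `S`. But `head f` is the tail of the next edge, or of `e₀` at
        -- the end.
        f-outside Sf = head-outside rest eq rot-f (subst (S ∘ head)
          (trans (cong (λ r → rotor r (tail f)) (sym eq))
            (lastOut-split pre f post (d (tail f))
              (All.map (λ ¬Sg p → ¬Sg (subst S (sym p) Sf)) rest)))
          (closed (tail f) Sf))

    -- Realising an equivalence by legal routings

    supplies-all : ∀ {e₀ rs} → Rotation t (e₀ ∷ rs) → ∀ v → ∃ (λ c → Supplies (tail e₀) c v)
    supplies-all {e₀} {rs} rot v = subst (λ v → ∃ (λ c → Supplies (tail e₀) c v)) (wf-d v)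
      (supplies-along (tail e₀) [] e₀ rs rot
        ((λ _ → 0) , (λ y _ → ℤ.≤-reflexive (sym (fireGain-nothing y))) , λ p → ⊥-elim (p refl))
        (tour-∈ rot (d v)))

    -- Adds up, over all `v`, `f v` copies of a firing vector supplying `v`; no summand takes chips
    -- from a vertex other than the sink.
    supply : ∀ {e₀ rs} → Rotation t (e₀ ∷ rs) → (f : Fin n → ℕ) →
      Σ (Fin n → ℕ) λ c → ∀ u → u ≢ tail e₀ → + f u ≤ fireGain c u
    supply {e₀} {rs} rot f with onList (allFin n)
      where
      w = tail e₀
      onList : ∀ us → Σ (Fin n → ℕ) λ c → (∀ u → u ≢ w → + 0 ≤ fireGain c u) ×
        (∀ {u} → u ∈ us → u ≢ w → + f u ≤ fireGain c u)
      onList [] = (λ _ → 0) , (λ u _ → ℤ.≤-reflexive (sym (fireGain-nothing u))) , λ ()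
      onList (v ∷ us) with supplies-all rot v | onList us
      ... | c₁ , nonNeg₁ , pos | c₂ , nonNeg₂ , covers = c , nonNeg , λ where
          (here refl) u≢w → subst₂ _≤_ (trans (ℤ.+-identityʳ _) (ℤ.*-identityʳ (+ f v))) (sym (c≡ v))
            (ℤ.+-mono-≤ (ℤ.*-monoˡ-≤-nonNeg (+ f v) (pos u≢w)) (nonNeg₂ v u≢w))
          {u} (there u∈) u≢w → subst₂ _≤_ (ℤ.+-identityˡ (+ f u)) (sym (c≡ u))
            (ℤ.+-mono-≤ (scaled u u≢w) (covers u∈ u≢w))
        where
        c : Fin n → ℕ
        c u = f v ℕ.* c₁ u ℕ.+ c₂ u
        c≡ : ∀ u → fireGain c u ≡ + f v * fireGain c₁ u + fireGain c₂ u
        c≡ u = trans (fireGain-+ (λ u → f v ℕ.* c₁ u) c₂ u) (cong (_+ fireGain c₂ u) (fireGain-* (f v) c₁ u))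
        scaled : ∀ u → u ≢ w → + 0 ≤ + f v * fireGain c₁ u
        scaled u u≢w = subst (_≤ + f v * fireGain c₁ u) (ℤ.*-zeroʳ (+ f v))
          (ℤ.*-monoˡ-≤-nonNeg (+ f v) (nonNeg₁ u u≢w))
        nonNeg : ∀ u → u ≢ w → + 0 ≤ fireGain c u
        nonNeg u u≢w = subst (+ 0 ≤_) (sym (c≡ u)) (ℤ.+-mono-≤ (scaled u u≢w) (nonNeg₂ u u≢w))
    ... | c , _ , covers = c , λ u → covers (∈-allFin u)

    -- The vector `k` is changed by full turns only: `N` turns are added at every vertex, which has
    -- no effect, and `c v` turns at `v` are split off and carried out beforehand as firings,
    -- leading to `x′`. What remains is `l`, which vanishes at the sink.
    realize : Eulerian D → ∀ {e₀ rs} → Rotation t (e₀ ∷ rs) → ∀ {x b} → WellFormed b →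
      b (tail e₀) ≡ rotor (e₀ ∷ rs) (tail e₀) → (x , b) ⇝ ((λ _ → + 0) , rotor (e₀ ∷ rs)) →
      Σ (Chips D) λ x′ → _∼_ D x′ x × (∀ u → u ≢ tail e₀ → + 0 ≤ x′ u) ×
      Σ (Chips D) λ y → Σ (Rotors D) λ ρ′ → Star (LegalAway D (tail e₀)) (x′ , b) (y , ρ′) ×
        (∀ u → u ≢ tail e₀ → y u ≡ + 0) × (∀ v → ρ′ v ≡ rotor (e₀ ∷ rs) v)
    realize eul {e₀} {rs} rot {x} {b} wf b≡ (route k k-rotors k-chips) =
      x′ , x′∼x , x′≥0 , legal-routing w σ acyclic (proj₁ (total l)) x′ b l wf (proj₂ (total l)) lw≡0 x′≥0 l-rotors
        (λ u _ → l-chips u)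
      where
      w : Fin n
      w = tail e₀
      σ : Rotors D
      σ = rotor (e₀ ∷ rs)
      acyclic : ∀ k → k w ≡ 0 → (∀ v → k v ≢ 0 → k (head (σ v)) ≢ 0) → ∀ v → k v ≡ 0
      acyclic k kw≡0 closed v = decidable-stable (k v ℕ.≟ 0)
        (rotor-acyclic rot (λ v → k v ≢ 0) (λ v → ¬? (k v ℕ.≟ 0)) (λ p → p kw≡0) closed v)
      instance
        deg≢0 : ℕ.NonZero (deg w)
        deg≢0 = ℕ.>-nonZero (deg-positive {e₀} refl)
      q : ℕ
      q = k w / deg w
      -- The rotor at `w` is the same before and after, so `k w` consists of full turns: the
      -- remainder modulo the degree fixes the rotor and is 0 by `advance-fixed-<`.
      kw≡ : k w ≡ q ℕ.* deg w
      kw≡ = trans (m≡m%n+[m/n]*n (k w) (deg w)) (cong (ℕ._+ q ℕ.* deg w) r≡0)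
        where
        r : ℕ
        r = k w % deg w
        fixed : advance r (b w) ≡ b w
        fixed = begin
          advance r (b w)
            ≡⟨ cong (advance r) (advance-*deg′ wf q w) ⟨
          advance r (advance (q ℕ.* deg w) (b w))
            ≡⟨ advance-+ (q ℕ.* deg w) r (b w) ⟨
          advance (q ℕ.* deg w ℕ.+ r) (b w)
            ≡⟨ cong (λ i → advance i (b w)) (trans (ℕ.+-comm _ r) (sym (m≡m%n+[m/n]*n (k w) (deg w)))) ⟩
          advance (k w) (b w)
            ≡⟨ trans (k-rotors w) (sym b≡) ⟩
          b w ∎
          where open ≡-Reasoning
        r≡0 : r ≡ 0
        r≡0 = advance-fixed-< r (b w) fixed (subst (λ v → r ℕ.< deg v) (sym (wf w)) (m%n<n (k w) (deg w)))
      c₀ : Fin n → ℕ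
      c₀ = proj₁ (supply rot (λ u → ℤ.∣ x u ∣))
      N a : ℕ
      N = proj₁ (bounded c₀)
      a = q ℕ.+ N ∸ c₀ w
      -- Extra firings of the sink only add chips elsewhere; a is chosen so that l vanishes at w.
      c : Fin n → ℕ
      c v = c₀ v ℕ.+ a ℕ.* δ w v
      c-sink : c w ≡ q ℕ.+ N
      c-sink = trans (cong (λ i → c₀ w ℕ.+ i) (trans (cong (a ℕ.*_) (δ-≡ {a = w} refl)) (ℕ.*-identityʳ a)))
        (ℕ.m+[n∸m]≡n (ℕ.≤-trans (proj₂ (bounded c₀) w) (ℕ.m≤n+m N q)))
      c-other : ∀ {v} → v ≢ w → c v ≡ c₀ v
      c-other {v} v≢w = trans (cong (λ i → c₀ v ℕ.+ a ℕ.* i) (δ-≢ (v≢w ∘ sym)))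
        (trans (cong (c₀ v ℕ.+_) (ℕ.*-zeroʳ a)) (ℕ.+-identityʳ (c₀ v)))
      fireGain-c : ∀ u → u ≢ w → + ℤ.∣ x u ∣ ≤ fireGain c u
      fireGain-c u u≢w = subst₂ _≤_ (ℤ.+-identityʳ _) (sym c≡)
        (ℤ.+-mono-≤ (proj₂ (supply rot (λ u → ℤ.∣ x u ∣)) u u≢w) (ℤ.+≤+ {n = a ℕ.* nEdges D w u} z≤n))
        where
        δ≡0 : + nEdges D w u - + (δ w u ℕ.* deg u) ≡ + nEdges D w u
        δ≡0 = trans (cong (λ i → + nEdges D w u - + (i ℕ.* deg u)) (δ-≢ (u≢w ∘ sym))) (ℤ.+-identityʳ _)
        c≡ : fireGain c u ≡ fireGain c₀ u + + (a ℕ.* nEdges D w u)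
        c≡ = trans (fireGain-+ c₀ (λ v → a ℕ.* δ w v) u) (cong (ℤ._+_ (fireGain c₀ u))
          (trans (fireGain-* a (δ w) u) (trans (cong (+ a *_) (trans (fireGain-δ w u) δ≡0)) (sym (ℤ.pos-* a _)))))
      x′ : Chips D
      x′ u = x u + fireGain c u
      x′≥0 : ∀ u → u ≢ w → + 0 ≤ x′ u
      x′≥0 u u≢w = ℤ.≤-trans (0≤i+∣i∣ (x u)) (ℤ.+-monoʳ-≤ (x u) (fireGain-c u u≢w))
        where
        0≤i+∣i∣ : ∀ i → + 0 ≤ i + + ℤ.∣ i ∣
        0≤i+∣i∣ (+ i)      = ℤ.+≤+ z≤n
        0≤i+∣i∣ ℤ.-[1+ i ] = ℤ.≤-reflexive (sym (ℤ.+-inverseˡ (+ suc i)))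
      x′∼x : _∼_ D x′ x
      -- The firings `c` are undone by their complement in a constant vector. The constant is
      -- `suc M` instead of `M` so that the complement has the positive total that `fireGain⇒∼`
      -- demands.
      x′∼x with bounded c
      ... | M , c≤M with total (λ v → suc M ∸ c v)
      ... | zero , p = ⊥-elim (ℕ.m>n⇒m∸n≢0 (s≤s (c≤M w)) (sum≡0⇒≡0 (λ v → suc M ∸ c v) p w))
      ... | suc T , p = fireGain⇒∼ T (λ v → suc M ∸ c v) p λ u → sym (begin
        x u + fireGain c u + fireGain (λ v → suc M ∸ c v) u
          ≡⟨ ℤ.+-assoc (x u) _ _ ⟩
        x u + (fireGain c u + fireGain (λ v → suc M ∸ c v) u)
          ≡⟨ cong (ℤ._+_ (x u)) (fireGain-+ c (λ v → suc M ∸ c v) u) ⟨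
        x u + fireGain (λ v → c v ℕ.+ (suc M ∸ c v)) u
          ≡⟨ cong (ℤ._+_ (x u)) (fireGain-cong (λ v → ℕ.m+[n∸m]≡n (ℕ.m≤n⇒m≤1+n (c≤M v))) u) ⟩
        x u + fireGain (λ _ → suc M) u
          ≡⟨ cong (ℤ._+_ (x u)) (fireGain-const eul (suc M) u) ⟩
        x u + + 0
          ≡⟨ ℤ.+-identityʳ (x u) ⟩
        x u ∎)
        where open ≡-Reasoning
      l : Fin n → ℕ
      l v = N ℕ.* deg v ℕ.+ k v ∸ c v ℕ.* deg v
      cw : c w ℕ.* deg w ≡ N ℕ.* deg w ℕ.+ k w
      cw = trans (cong (ℕ._* deg w) (trans c-sink (ℕ.+-comm q N)))
        (trans (ℕ.*-distribʳ-+ (deg w) N q) (cong (N ℕ.* deg w ℕ.+_) (sym kw≡)))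
      -- Equality holds at the sink; elsewhere `c v` is `c₀ v`, which is at most `N`. Hence the
      -- subtraction in `l` is exact.
      c≤ : ∀ v → c v ℕ.* deg v ℕ.≤ N ℕ.* deg v ℕ.+ k v
      c≤ v with v ≟ w
      ... | yes refl = ℕ.≤-reflexive cw
      ... | no v≢w = ℕ.≤-trans (ℕ.*-monoˡ-≤ (deg v)
        (ℕ.≤-trans (ℕ.≤-reflexive (c-other v≢w)) (proj₂ (bounded c₀) v))) (ℕ.m≤m+n _ (k v))
      c+l : ∀ v → c v ℕ.* deg v ℕ.+ l v ≡ N ℕ.* deg v ℕ.+ k v
      c+l v = ℕ.m+[n∸m]≡n (c≤ v)
      lw≡0 : l w ≡ 0
      lw≡0 = trans (cong (λ i → N ℕ.* deg w ℕ.+ k w ∸ i) cw) (ℕ.n∸n≡0 (N ℕ.* deg w ℕ.+ k w))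
      advance-after : ∀ M v i → advance (M ℕ.* deg v ℕ.+ i) (b v) ≡ advance i (b v)
      advance-after M v i = trans (advance-+ (M ℕ.* deg v) i (b v)) (cong (advance i) (advance-*deg′ wf M v))
      l-rotors : ∀ v → advance (l v) (b v) ≡ σ v
      l-rotors v = trans (sym (advance-after (c v) v (l v)))
        (trans (cong (λ i → advance i (b v)) (c+l v)) (trans (advance-after N v (k v)) (k-rotors v)))
      gain-after : ∀ M j u → gain b (λ v → M v ℕ.* deg v ℕ.+ j v) u ≡ fireGain M u + gain b j u
      gain-after M j u = trans (gain-+ b (λ v → M v ℕ.* deg v) j u)
        (cong₂ _+_ (gain-*deg wf M u) (gain-cong {k = j} (λ v → advance-*deg′ wf (M v) v) (λ _ → refl) u))
      l-chips : ∀ u → x′ u + gain b l u ≡ + 0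
      l-chips u = begin
        x u + fireGain c u + gain b l u
          ≡⟨ ℤ.+-assoc (x u) _ _ ⟩
        x u + (fireGain c u + gain b l u)
          ≡⟨ cong (ℤ._+_ (x u)) (gain-after c l u) ⟨
        x u + gain b (λ v → c v ℕ.* deg v ℕ.+ l v) u
          ≡⟨ cong (ℤ._+_ (x u)) (gain-cong {b} (λ _ → refl) c+l u) ⟩
        x u + gain b (λ v → N ℕ.* deg v ℕ.+ k v) u
          ≡⟨ cong (ℤ._+_ (x u)) (trans (gain-after (λ _ → N) k u)
               (trans (cong (_+ gain b k u) (fireGain-const eul N u)) (ℤ.+-identityˡ _))) ⟩
        x u + gain b k u
          ≡⟨ k-chips u ⟩
        + 0 ∎
        where open ≡-Reasoning

-- From the rotor action to equivalence, and change of the starting edge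

module _ (D : RibbonDigraph) (eul : Eulerian D) where
  open RibbonDigraph D
  open Rotor D
  open Gain D
  open Reach D

  -- The rotor at u never moves, so turning it to its position in a and a' changes nothing; the
  -- chips at u vanish because routing preserves their total number, which is 0.
  legal⇒⇝-zero : ∀ u {x x₁ y : Chips D} {ρ ρ' a a' : Rotors D} →
    WellFormed ρ → WellFormed a → a u ≡ a' u →
    (∀ v → v ≢ u → ρ v ≡ a v) → (∀ v → v ≢ u → ρ' v ≡ a' v) →
    sum x ≡ + 0 → _∼_ D x₁ x → Star (LegalAway D u) (x₁ , ρ) (y , ρ') →
    (∀ v → v ≢ u → y v ≡ + 0) → (x , a) ⇝ ((λ _ → + 0) , a')
  legal⇒⇝-zero u {x} {x₁} {y} {ρ} {ρ'} {a} {a'} wf-ρ wf-a a≡a' ρ≡a ρ'≡a' sum-x x₁∼x path y≡0 =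
    ⇝-trans x⇝y (⇝-reflexive y≡0-everywhere (λ _ → refl))
    where
    ρu≡ρ'u : ρ u ≡ ρ' u
    ρu≡ρ'u = sym (legal-sink path)
    turned : ∃ λ j → advance j (ρ u) ≡ a u
    turned = advance-transitive (trans (wf-ρ u) (sym (wf-a u)))
    j : ℕ
    j = proj₁ turned
    turn-ρ : ∀ v → a v ≡ turn u j ρ v
    turn-ρ v with v ≟ u
    ... | yes refl = sym (trans (turn-at u j ρ) (proj₂ turned))
    ... | no v≢u   = sym (trans (turn-other j ρ v≢u) (ρ≡a v v≢u))
    turn-ρ' : ∀ v → turn u j ρ' v ≡ a' v
    turn-ρ' v with v ≟ u
    ... | yes refl = trans (turn-at u j ρ') (trans (cong (advance j) (sym ρu≡ρ'u)) (trans (proj₂ turned) a≡a'))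
    ... | no v≢u   = trans (turn-other j ρ' v≢u) (ρ'≡a' v v≢u)
    x⇝y : (x , a) ⇝ (y , a')
    x⇝y = ⇝-trans (⇝-sym eul wf-a (∼⇒⇝ wf-a x₁∼x))
      (⇝-trans (⇝-reflexive (λ _ → refl) turn-ρ)
        (⇝-trans (⇝-turn eul u j wf-ρ ρu≡ρ'u (legal⇒⇝ path)) (⇝-reflexive (λ _ → refl) turn-ρ')))
    sum-y : sum y ≡ + 0
    sum-y = trans (⇝-sum x⇝y) sum-x
    y≡0-everywhere : ∀ v → y v ≡ + 0
    y≡0-everywhere v with v ≟ u
    ... | no v≢u   = y≡0 v v≢u
    ... | yes refl = trans (sym (sum-single y u y≡0)) sum-y

module _ (D : RibbonDigraph) where
  open Reach D

  -- With `x` added, the chain runs from `(p + x, b)` through `(q + x, a)` and `(q, a')` to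
  -- `(p, b')`; then `p` is subtracted. In the application `p` and `q` are single chips at the two
  -- roots.
  ⇝-conjugate : ∀ {x p q : Chips D} {a a' b b' : Rotors D} →
    (p , b) ⇝ (q , a) → (q , a') ⇝ (p , b') → (x , a) ⇝ ((λ _ → + 0) , a') → (x , b) ⇝ ((λ _ → + 0) , b')
  ⇝-conjugate {x} {p} {q} {a} {a'} {b} {b'} b⇝a a'⇝b' a⇝a' =
    ⇝-trans (⇝-reflexive (λ v → cancel (p v) (x v)) (λ _ → refl))
      (⇝-trans (⇝-shift (λ v → - p v) (⇝-trans (⇝-shift x b⇝a) (⇝-trans middle a'⇝b')))
        (⇝-reflexive (λ v → ℤ.+-inverseʳ (p v)) (λ _ → refl)))
    where
    cancel : ∀ a b → b ≡ a + b + - a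
    cancel = solve-∀
    middle : ((λ v → q v + x v) , a) ⇝ (q , a')
    middle = ⇝-trans (⇝-reflexive (λ v → ℤ.+-comm (q v) (x v)) (λ _ → refl))
      (⇝-trans (⇝-shift q a⇝a') (⇝-reflexive (λ v → ℤ.+-identityˡ (q v)) (λ _ → refl)))

theorem3p1 : (D : RibbonDigraph) → WeaklyConnected D → Eulerian D →
    (uv wz : Fin (RibbonDigraph.m D)) →
    (x : Fin (RibbonDigraph.n D) → ℤ) → sumℤ D x ≡ + 0 →
    (E E' : List (Fin (RibbonDigraph.m D))) → CompatibleTour D E → CompatibleTour D E' →
    (A₁ A₁' A₂ A₂' : Subset (RibbonDigraph.m D)) →
    IsA D uv E A₁ → IsA D uv E' A₁' → IsA D wz E A₂ → IsA D wz E' A₂' →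
    RotorAct D (RibbonDigraph.tail D uv) x A₁ A₁' →
    RotorAct D (RibbonDigraph.tail D wz) x A₂ A₂'
theorem3p1 D conn eul uv wz x sum-x E E' tour tour' A₁ A₁' A₂ A₂'
  (as₁ , bs₁ , E≡₁ , isA₁) (as₁' , bs₁' , E'≡₁ , isA₁')
  (as₂ , bs₂ , E≡₂ , isA₂) (as₂' , bs₂' , E'≡₂ , isA₂')
  (x₁ , x₁∼x , _ , _ , _ , ρ , wf-ρ , _ , ρ∈A₁ , y , ρ' , path , y≡0 , inA₁') =
  let x′ , x′∼x , x′≥0 , z , σ , path′ , z≡0 , σ≡b' = T'.realize d wf-d eul rot₂' wf-b b≡b' b⇝b'
  -- The free choice of an out-edge at the sink is settled as `b w`, so `b` itself is the initial
  -- rotor configuration.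
  in x′ , x′∼x , x′≥0 , b w , wf-b w , b , wf-b , refl , b∈A₂ , z , σ , path′ , z≡0 , λ f →
    mk⇔ (λ f∈ → let f≢w , p = Equivalence.to (spec' f) (Equivalence.to (isA₂' f) f∈)
                in f≢w , trans (σ≡b' (tail f)) p)
        (λ { (f≢w , p) → Equivalence.from (isA₂' f)
               (Equivalence.from (spec' f) (f≢w , trans (sym (σ≡b' (tail f))) p)) })
  where
  open RibbonDigraph D
  open Rotor D
  open Gain D
  open Reach D
  module T  = Tour D E tour
  module T' = Tour D E' tour'
  u w : Fin n
  u = tail uv
  w = tail wz
  -- Some out-edge at each vertex, as the default for `lastOut`; both tours share it.
  d : Rotors D
  d v = proj₁ (T.out-edge conn uv v)
  wf-d : WellFormed d
  wf-d v = proj₂ (T.out-edge conn uv v)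
  a a' b b' : Rotors D
  a  = T.rotor d wf-d (uv ∷ bs₁ ++ as₁)
  a' = T'.rotor d wf-d (uv ∷ bs₁' ++ as₁')
  b  = T.rotor d wf-d (wz ∷ bs₂ ++ as₂)
  b' = T'.rotor d wf-d (wz ∷ bs₂' ++ as₂')
  wf-a : WellFormed a
  wf-a = T.wf-rotor d wf-d (uv ∷ bs₁ ++ as₁)
  wf-a' : WellFormed a'
  wf-a' = T'.wf-rotor d wf-d (uv ∷ bs₁' ++ as₁')
  wf-b : WellFormed b
  wf-b = T.wf-rotor d wf-d (wz ∷ bs₂ ++ as₂)
  wf-b' : WellFormed b'
  wf-b' = T'.wf-rotor d wf-d (wz ∷ bs₂' ++ as₂')
  rot₁ : Rotation E (uv ∷ bs₁ ++ as₁)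
  rot₁ = as₁ , uv ∷ bs₁ , E≡₁ , refl
  rot₁' : Rotation E' (uv ∷ bs₁' ++ as₁')
  rot₁' = as₁' , uv ∷ bs₁' , E'≡₁ , refl
  rot₂ : Rotation E (wz ∷ bs₂ ++ as₂)
  rot₂ = as₂ , wz ∷ bs₂ , E≡₂ , refl
  rot₂' : Rotation E' (wz ∷ bs₂' ++ as₂')
  rot₂' = as₂' , wz ∷ bs₂' , E'≡₂ , refl
  -- In either tour the last exit from the root is the ribbon predecessor of the first edge `uv`.
  a≡a' : a u ≡ a' u
  a≡a' = next-injective (trans (wf-a u) (sym (wf-a' u)))
    (trans (T.next-lastOut (d u) rot₁) (sym (T'.next-lastOut (d u) rot₁')))
  b≡b' : b w ≡ b' w
  b≡b' = next-injective (trans (wf-b w) (sym (wf-b' w)))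
    (trans (T.next-lastOut (d w) rot₂) (sym (T'.next-lastOut (d w) rot₂')))
  spec' : ∀ f → LastOut D w (wz ∷ bs₂' ++ as₂') f ⇔ (¬ tail f ≡ w × b' (tail f) ≡ f)
  spec' = T'.lastOut⇔rotor d wf-d rot₂' w
  b∈A₂ : ∀ v → v ≢ w → b v Subset.∈ A₂
  b∈A₂ v v≢w = Equivalence.from (isA₂ (b v)) (Equivalence.from (T.lastOut⇔rotor d wf-d rot₂ w (b v))
    ((λ p → v≢w (trans (sym (wf-b v)) p)) , cong b (wf-b v)))
  wf-ρ' : WellFormed ρ'
  wf-ρ' = ⇝-wellFormed wf-ρ (legal⇒⇝ path)
  ρ≡a : ∀ v → v ≢ u → ρ v ≡ a v
  ρ≡a v v≢u = trans (sym (proj₂ (Equivalence.to (T.lastOut⇔rotor d wf-d rot₁ u (ρ v))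
    (Equivalence.to (isA₁ (ρ v)) (ρ∈A₁ v v≢u))))) (cong a (wf-ρ v))
  ρ'≡a' : ∀ v → v ≢ u → ρ' v ≡ a' v
  ρ'≡a' v v≢u = trans (sym (proj₂ (Equivalence.to (T'.lastOut⇔rotor d wf-d rot₁' u (ρ' v))
    (Equivalence.to (isA₁' (ρ' v)) (Equivalence.from (inA₁' (ρ' v))
      ((λ p → v≢u (trans (sym (wf-ρ' v)) p)) , cong ρ' (wf-ρ' v))))))) (cong a' (wf-ρ' v))
  a⇝a' : (x , a) ⇝ ((λ _ → + 0) , a')
  a⇝a' = legal⇒⇝-zero D eul u wf-ρ wf-a a≡a' ρ≡a ρ'≡a' (trans (sym (sumℤ≡sum D x)) sum-x) x₁∼x path y≡0
  b⇝b' : (x , b) ⇝ ((λ _ → + 0) , b')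
  b⇝b' = ⇝-conjugate D (T.tour-connected d wf-d eul rot₂ rot₁) (T'.tour-connected d wf-d eul rot₁' rot₂') a⇝a'
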